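{- Fix an integer $d\geq 2$. The generating series $W=\sum_{n\geq0}w_{d,n}(t)x^n\in\left(\mathbb{Q}[t,t^{ -1}]\right)[[x]]$ satisfies the algebraic equation $$W=1+tx\left(1+t^{ -1}xW^d\right)^d.$$
   Context: For $n\geq0$ let $P_{(d-1)n}$ be a strictly convex polygon with $(d-1)n+2$ vertices and a marked boundary edge $e_*$. A $d$-dissection of it is a decomposition into $n$ non-overlapping convex polygons each having $d+1$ vertices, all among the vertices of $P_{(d-1)n}$. Its checkerboard colouring colours each of these polygons black or white such that the unique polygon containing $e_*$ is black and polygons sharing an edge have different colours; let $n_b,n_w$ be the numbers of black and white polygons. Define $w_{d,n}(t)=\sum t^{n_b-n_w}$, the sum over all $d$-dissections of $P_{(d-1)n}$, with $w_{d,0}=1$. -}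

module Defs where

open import Data.Nat as ℕ using (ℕ; zero; suc; _∸_; _*_; _+_; _<ᵇ_; _≤ᵇ_; _≡ᵇ_)
open import Data.Integer as ℤ using (ℤ; +_)
open import Data.Rational as ℚ using (ℚ; 0ℚ; 1ℚ)
open import Data.Bool using (Bool; true; false; _∧_; _∨_; not; _xor_; if_then_else_)
open import Data.List using (List; []; _∷_; _++_; [_]; map; concatMap; length; upTo; foldr; zip; filterᵇ)
open import Data.Product using (_×_; _,_)
open import Data.Bool.ListAction using (all; any)
open import Relation.Nullary using (does)
open import Relation.Binary.PropositionalEquality using (_≡_)

-- Laurent polynomials in t over ℚ, as finite lists of monomials
-- (exponent , coefficient); two are equal iff all coefficients agree.

LPoly : Set
LPoly = List (ℤ × ℚ)

coeff : LPoly → ℤ → ℚ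
coeff p k = foldr (λ { (e , c) acc → if does (e ℤ.≟ k) then c ℚ.+ acc else acc }) 0ℚ p

lpMul : LPoly → LPoly → LPoly
lpMul p q = concatMap (λ { (e , c) → map (λ { (e′ , c′) → (e ℤ.+ e′ , c ℚ.* c′) }) q }) p

lpShift : ℤ → LPoly → LPoly
lpShift a p = map (λ { (e , c) → (a ℤ.+ e , c) }) p

PS : Set
PS = ℕ → LPoly

psOne : PS
psOne zero    = [ (+ 0 , 1ℚ) ]
psOne (suc _) = []

_⊕_ : PS → PS → PS
(A ⊕ B) n = A n ++ B n

_⊗_ : PS → PS → PS
(A ⊗ B) n = concatMap (λ i → lpMul (A i) (B (n ∸ i))) (upTo (suc n))

_^ˢ_ : PS → ℕ → PS
A ^ˢ zero  = psOne
A ^ˢ suc k = A ⊗ (A ^ˢ k)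

t^_x·_ : ℤ → PS → PS
(t^ a x· A) zero    = []
(t^ a x· A) (suc n) = lpShift a (A n)

_≈ˢ_ : PS → PS → Set
A ≈ˢ B = ∀ (n : ℕ) (k : ℤ) → coeff (A n) k ≡ coeff (B n) k

-- Combinatorics of d-dissections.
-- The polygon P with m vertices has vertices labelled 0,1,…,m-1 in cyclic
-- order; its boundary edges are {i,i+1} and {0,m-1}; the marked edge e_* is
-- {0,m-1}.  A sub-polygon with vertices among those of P is given by the
-- increasing list of its vertex labels.  Edges are pairs (a , b) with a < b.

choose : ℕ → List ℕ → List (List ℕ)
choose zero    xs       = [ [] ]
choose (suc k) []       = []
choose (suc k) (x ∷ xs) = map (x ∷_) (choose k xs) ++ choose (suc k) xs

sublists : {A : Set} → List A → List (List A)
sublists []       = [ [] ]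
sublists (x ∷ xs) = map (x ∷_) (sublists xs) ++ sublists xs

boolLists : ℕ → List (List Bool)
boolLists zero    = [ [] ]
boolLists (suc k) = map (true ∷_) (boolLists k) ++ map (false ∷_) (boolLists k)

consec : List ℕ → List (ℕ × ℕ)
consec (x ∷ y ∷ r) = (x , y) ∷ consec (y ∷ r)
consec _           = []

lastOr : ℕ → List ℕ → ℕ
lastOr x []      = x
lastOr _ (y ∷ r) = lastOr y r

edges : List ℕ → List (ℕ × ℕ)
edges []      = []
edges (x ∷ r) = consec (x ∷ r) ++ [ (x , lastOr x r) ]

eqEdge : ℕ × ℕ → ℕ × ℕ → Bool
eqEdge (a , b) (c , d) = (a ≡ᵇ c) ∧ (b ≡ᵇ d)

hasEdge : List ℕ → ℕ × ℕ → Bool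
hasEdge p e = any (eqEdge e) (edges p)

boundaryEdges : ℕ → List (ℕ × ℕ)
boundaryEdges m = map (λ i → (i , suc i)) (upTo (m ∸ 1)) ++ [ (0 , m ∸ 1) ]

isBoundary : ℕ → ℕ × ℕ → Bool
isBoundary m e = any (eqEdge e) (boundaryEdges m)

markedEdge : ℕ → ℕ × ℕ
markedEdge m = (0 , m ∸ 1)

-- Two convex polygons whose vertices are vertices of the strictly convex
-- polygon P have disjoint interiors iff all vertices of q lie on the closed
-- boundary arc of P between two cyclically consecutive vertices of p.
nonOverlapping : List ℕ → List ℕ → Bool
nonOverlapping [] q = true
nonOverlapping (x ∷ r) q =
  any (λ { (a , b) → all (λ v → (a ≤ᵇ v) ∧ (v ≤ᵇ b)) q }) (consec (x ∷ r))
  ∨ all (λ v → (v ≤ᵇ x) ∨ (lastOr x r ≤ᵇ v)) q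

pairwise : {A : Set} → (A → A → Bool) → List A → Bool
pairwise R []       = true
pairwise R (x ∷ xs) = all (R x) xs ∧ pairwise R xs

nVert : ℕ → ℕ → ℕ
nVert d n = (d ∸ 1) * n + 2

candidates : ℕ → ℕ → List (List ℕ)
candidates d m = choose (suc d) (upTo m)

-- D (a set of distinct candidate pieces) is a d-dissection of the m-gon:
-- n pieces, pairwise interior-disjoint, and their union is all of P
-- (every boundary edge of P is an edge of a piece, and every edge of a piece
-- that is a diagonal of P is also an edge of another piece).
isDissection : ℕ → ℕ → List (List ℕ) → Bool
isDissection m n D =
  (length D ≡ᵇ n)
  ∧ pairwise nonOverlapping D
  ∧ all (λ e → any (λ p → hasEdge p e) D) (boundaryEdges m)
  ∧ all (λ p → all (λ e → isBoundary m e ∨ (2 ≤ᵇ length (filterᵇ (λ q → hasEdge q e) D))) (edges p)) D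

adjacent : List ℕ → List ℕ → Bool
adjacent p q = any (hasEdge q) (edges p)

-- c assigns a colour to each piece (true = black, false = white);
-- checkerboard: the piece containing e_* is black, adjacent pieces differ.
isCheckerboard : ℕ → List (List ℕ) → List Bool → Bool
isCheckerboard m D c =
  (length c ≡ᵇ length D)
  ∧ all (λ { (p , b) → not (hasEdge p (markedEdge m)) ∨ b }) (zip D c)
  ∧ pairwise (λ { (p , b) (q , b′) → not (adjacent p q) ∨ (b xor b′) }) (zip D c)

count : Bool → List Bool → ℕ
count b c = length (filterᵇ (λ x → not (x xor b)) c)

blackMinusWhite : List Bool → ℤ
blackMinusWhite c = (+ count true c) ℤ.- (+ count false c)

w : ℕ → ℕ → LPoly
w d zero = [ (+ 0 , 1ℚ) ]
w d n@(suc _) =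
  concatMap
    (λ D → map (λ c → (blackMinusWhite c , 1ℚ))
               (filterᵇ (isCheckerboard m D) (boolLists (length D))))
    (filterᵇ (isDissection m n) (sublists (candidates d m)))
  where m = nVert d n

W : ℕ → PS
W d = w d

{-# OPTIONS --safe #-}
module Submission where

-- Cutting off the piece that contains the marked edge splits a d-dissection into d dissections of
-- smaller polygons, some of them just an edge; so d-dissections with n pieces correspond to plane d-ary
-- trees with n nodes. Neighbouring pieces are parent and child in the tree, hence the only checkerboard
-- colouring alternates along the levels. Let B and B̄ be the series of trees with black and with white
-- root, the weight being t to the power #black − #white. Removing the root gives B = 1 + t x B̄ᵈ and
-- B̄ = 1 + t⁻¹ x Bᵈ. As every coefficient is 1, these are identities of multisets of monomials.

open import Defs
open import Data.Bool using (Bool; true; false; T; not; _∧_; _∨_; _xor_)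
open import Data.Bool.Properties using (T?; T-∧; T-∨; T-≡; not-¬; ¬-not)
open import Data.Bool.ListAction using (any; all)
open import Data.Empty using (⊥-elim)
open import Data.Integer as ℤ using (ℤ; +_; -[1+_])
import Data.Integer.Properties as ℤ
open import Algebra.Properties.CommutativeSemigroup ℤ.+-commutativeSemigroup using (x∙yz≈y∙xz)
open import Data.List.Base using (List; []; _∷_; _++_; [_]; map; concatMap; length; upTo; foldr; zip; filter; filterᵇ; cartesianProductWith)
open import Data.List.Properties using (map-cong; map-∘; map-++; map-concatMap; concatMap-map; concatMap-pure; length-map; length-++; ∷-injectiveˡ; ∷-injectiveʳ; ≡-dec)
open import Data.List.Membership.Propositional using (_∈_; _∉_; find; lose)
open import Data.List.Membership.Propositional.Properties
open import Data.List.Membership.Setoid.Properties using (unique⇒irrelevant)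
open import Data.List.Membership.DecPropositional using (_∈?_)
open import Data.List.Relation.Binary.BagAndSetEquality using (∼bag⇒↭)
open import Data.List.Relation.Binary.Permutation.Propositional using (_↭_; ↭-refl; ↭-sym; ↭-trans; ↭-reflexive; prep; swap; module PermutationReasoning)
open import Data.List.Relation.Binary.Permutation.Propositional.Properties using (All-resp-↭; ∈-resp-↭; ↭-map-inv; ↭-length; ++⁺; shifts) renaming (map⁺ to map-↭)
open import Data.List.Relation.Unary.All as All using (All; []; _∷_)
import Data.List.Relation.Unary.All.Properties as All
open import Data.List.Relation.Unary.AllPairs as AllPairs using (AllPairs; []; _∷_)
import Data.List.Relation.Unary.AllPairs.Properties as AllPairs
open import Data.List.Relation.Unary.Any as Any using (Any; here; there)
import Data.List.Relation.Unary.Any.Properties as Any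
open import Data.List.Relation.Unary.Unique.Propositional using (Unique)
import Data.List.Relation.Unary.Unique.Propositional.Properties as Unique
open import Data.Nat using (ℕ; zero; suc; _+_; _*_; _∸_; _≤_; _<_; z≤n; s≤s; _≡ᵇ_; _≤ᵇ_)
open import Data.Nat.Properties
open import Data.Nat.Solver using (module +-*-Solver)
open +-*-Solver using (solve; con; _:+_; _:*_; _:=_)
open import Data.Product using (Σ; ∃; _×_; _,_; proj₁; proj₂)
open import Data.Rational as ℚ using (ℚ; 1ℚ)
import Data.Rational.Properties as ℚ
open import Data.Sum as Sum using (_⊎_; inj₁; inj₂; [_,_]′)
open import Data.Unit using (tt)
open import Function using (_∘_; id; Equivalence; mk↔ₛ′)
open import Relation.Nullary using (¬_; Dec; yes; no; does)
open import Relation.Binary.PropositionalEquality using (_≡_; _≢_; refl; sym; trans; cong; cong₂; subst; module ≡-Reasoning)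
open import Relation.Binary.PropositionalEquality.Properties using (setoid)

-- `isDissection` is a Boolean test without recursive structure: a count, pairwise non-overlap, and
-- conditions on which pieces own which edges. The main work is to extract a tree from it. Every gap
-- between consecutive vertices of a piece is either a boundary edge, hence a leaf, or has a second
-- owner; non-overlap confines that owner to the gap, where it becomes the root of a child.
-- Conversely, a piece that does not overlap a root spanning its interval must lie in one of the
-- root's gaps, so no piece is left over. Lists carry an order that the combinatorics does not have:
-- `sublists` and `boolLists` run in one order, trees in another. Since `coeff` ignores order,
-- everything is compared up to `↭`, and two duplicate-free lists with the same members are
-- permutations of each other. A leaf takes one unit of the line of vertex labels, so a subtree
-- occupies an interval of integers and the geometry reduces to comparing labels.

private variable
  A B : Set

-- Trees and their generating series

data Tree (d : ℕ) : Set
data Forest (d : ℕ) : ℕ → Set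

data Tree d where
  leaf : Tree d
  node : Forest d d → Tree d

data Forest d where
  []  : Forest d 0
  _∷_ : ∀ {k} → Tree d → Forest d k → Forest d (suc k)

nodes : ∀ {d} → Tree d → ℕ
nodesF : ∀ {d k} → Forest d k → ℕ
nodes leaf = 0
nodes (node f) = suc (nodesF f)
nodesF [] = 0
nodesF (t ∷ f) = nodes t + nodesF f

sign : Bool → ℤ
sign true = + 1
sign false = -[1+ 0 ]

weight : ∀ {d} → Bool → Tree d → ℤ
weightF : ∀ {d k} → Bool → Forest d k → ℤ
weight β leaf = + 0
weight β (node f) = sign β ℤ.+ weightF (not β) f
weightF β [] = + 0
weightF β (t ∷ f) = weight β t ℤ.+ weightF β f

-- The nesting of `concatMap` and `upTo` copies `_⊗_` and `_^ˢ_`, so that `forests-pow` is an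
-- equality of lists and not merely a permutation.
forests : ∀ {d} → (ℕ → List (Tree d)) → (k n : ℕ) → List (Forest d k)
forests A zero zero = [ [] ]
forests A zero (suc n) = []
forests A (suc k) n = concatMap (λ i → cartesianProductWith _∷_ (A i) (forests A k (n ∸ i))) (upTo (suc n))

-- The height bound only serves termination: it can be dropped once it reaches the number of nodes.
treesOfHeight≤ : ∀ d → ℕ → ℕ → List (Tree d)
treesOfHeight≤ d h zero = [ leaf ]
treesOfHeight≤ d zero (suc n) = []
treesOfHeight≤ d (suc h) (suc n) = map node (forests (treesOfHeight≤ d h) d n)

trees : ∀ d → ℕ → List (Tree d)
trees d n = treesOfHeight≤ d n n

concatMap-cong-∈ : (f g : A → List B) (xs : List A) → (∀ {x} → x ∈ xs → f x ≡ g x) →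
  concatMap f xs ≡ concatMap g xs
concatMap-cong-∈ f g [] eq = refl
concatMap-cong-∈ f g (x ∷ xs) eq = cong₂ _++_ (eq (here refl)) (concatMap-cong-∈ f g xs (eq ∘ there))

-- Agreement is asked for only up to `n`: this is all that a height bound can guarantee.
forests-cong : ∀ {d} {A B : ℕ → List (Tree d)} k n → (∀ {i} → i ≤ n → A i ≡ B i) → forests A k n ≡ forests B k n
forests-cong zero zero eq = refl
forests-cong zero (suc n) eq = refl
forests-cong (suc k) n eq = concatMap-cong-∈ _ _ (upTo (suc n)) λ {i} i∈ →
  cong₂ (cartesianProductWith _∷_) (eq (m<1+n⇒m≤n (∈-upTo⁻ i∈)))
    (forests-cong k (n ∸ i) (λ j≤ → eq (≤-trans j≤ (m∸n≤m n i))))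

treesOfHeight≤-stable : ∀ d {h h′ n} → n ≤ h → n ≤ h′ → treesOfHeight≤ d h n ≡ treesOfHeight≤ d h′ n
treesOfHeight≤-stable d z≤n z≤n = refl
treesOfHeight≤-stable d {n = suc n} (s≤s n≤h) (s≤s n≤h′) = cong (map node) (forests-cong d n λ i≤n →
  treesOfHeight≤-stable d (≤-trans i≤n n≤h) (≤-trans i≤n n≤h′))

trees-suc : ∀ d n → trees d (suc n) ≡ map node (forests (trees d) d n)
trees-suc d n = cong (map node) (forests-cong d n λ i≤n → treesOfHeight≤-stable d i≤n ≤-refl)

module _ {d} {A : ℕ → List (Tree d)} (nodes-A : ∀ {i t} → t ∈ A i → nodes t ≡ i) where

  ∈-forests⁻ : ∀ k n {f : Forest d k} → f ∈ forests A k n → nodesF f ≡ n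
  ∈-forests⁻ zero zero (here refl) = refl
  ∈-forests⁻ (suc k) n f∈ with find (∈-concatMap⁻ (λ i → cartesianProductWith _∷_ (A i) (forests A k (n ∸ i))) {xs = upTo (suc n)} f∈)
  ... | i , i∈ , f∈i with ∈-cartesianProductWith⁻ _∷_ (A i) _ f∈i
  ... | t , g , t∈ , g∈ , refl rewrite nodes-A t∈ | ∈-forests⁻ k (n ∸ i) g∈ =
    m+[n∸m]≡n (m<1+n⇒m≤n (∈-upTo⁻ i∈))

  -- Forests from different summands differ in the node count of their first tree.
  forests-unique : (∀ i → Unique (A i)) → ∀ k n → Unique (forests A k n)
  forests-unique uA zero zero = [] ∷ []
  forests-unique uA zero (suc n) = []
  forests-unique uA (suc k) n = Unique.concat⁺
    (All.map⁺ (All.tabulate λ {i} _ →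
      Unique.cartesianProductWith⁺ _∷_ (λ { refl → refl , refl }) (uA i) (forests-unique uA k (n ∸ i))))
    (AllPairs.map⁺ (AllPairs.map disjoint (Unique.upTo⁺ (suc n))))
    where
    disjoint : ∀ {i j} → i ≢ j → ∀ {f} → ¬ (f ∈ cartesianProductWith _∷_ (A i) (forests A k (n ∸ i))
                                         × f ∈ cartesianProductWith _∷_ (A j) (forests A k (n ∸ j)))
    disjoint {i} {j} i≢j (f∈i , f∈j)
      with ∈-cartesianProductWith⁻ _∷_ (A i) _ f∈i | ∈-cartesianProductWith⁻ _∷_ (A j) _ f∈j
    ... | t , _ , t∈i , _ , refl | .t , _ , t∈j , _ , refl = i≢j (trans (sym (nodes-A t∈i)) (nodes-A t∈j))

∈-treesOfHeight≤⁻ : ∀ d h n {t} → t ∈ treesOfHeight≤ d h n → nodes t ≡ n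
∈-treesOfHeight≤⁻ d h zero (here refl) = refl
∈-treesOfHeight≤⁻ d (suc h) (suc n) t∈ with ∈-map⁻ node t∈
... | f , f∈ , refl = cong suc (∈-forests⁻ (λ {i} → ∈-treesOfHeight≤⁻ d h i) d n f∈)

treesOfHeight≤-unique : ∀ d h n → Unique (treesOfHeight≤ d h n)
treesOfHeight≤-unique d h zero = [] ∷ []
treesOfHeight≤-unique d zero (suc n) = []
treesOfHeight≤-unique d (suc h) (suc n) = Unique.map⁺ (λ { refl → refl })
  (forests-unique (λ {i} → ∈-treesOfHeight≤⁻ d h i) (treesOfHeight≤-unique d h) d n)

∈-trees⁺ : ∀ {d} (t : Tree d) → t ∈ trees d (nodes t)
∈-forests⁺ : ∀ {d k} (f : Forest d k) → f ∈ forests (trees d) k (nodesF f)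
∈-trees⁺ leaf = here refl
∈-trees⁺ {d} (node f) = subst (node f ∈_) (sym (trees-suc d (nodesF f))) (∈-map⁺ node (∈-forests⁺ f))
∈-forests⁺ [] = here refl
∈-forests⁺ {d} {suc k} (t ∷ f) = ∈-concatMap⁺ _ (lose (∈-upTo⁺ (s≤s (m≤m+n (nodes t) (nodesF f))))
  (∈-cartesianProductWith⁺ _∷_ (∈-trees⁺ t)
    (subst (λ n → f ∈ forests (trees d) k n) (sym (m+n∸m≡n (nodes t) (nodesF f))) (∈-forests⁺ f))))

monomial : ℤ → ℤ × ℚ
monomial k = k , 1ℚ

series : ∀ d → Bool → PS
series d β n = map (monomial ∘ weight β) (trees d n)

lpMul-weight : ∀ {d k} β (ts : List (Tree d)) (fs : List (Forest d k)) →
  map (monomial ∘ weightF β) (cartesianProductWith _∷_ ts fs)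
    ≡ lpMul (map (monomial ∘ weight β) ts) (map (monomial ∘ weightF β) fs)
lpMul-weight β [] fs = refl
lpMul-weight β (t ∷ ts) fs = trans (map-++ _ (map (t ∷_) fs) _)
  -- `1ℚ ℚ.* 1ℚ` reduces to `1ℚ`, so a product of two monomials is a monomial by computation.
  (cong₂ _++_ (trans (sym (map-∘ fs)) (trans (map-cong (λ _ → refl) fs) (map-∘ fs))) (lpMul-weight β ts fs))

forests-pow : ∀ {d} β (A : ℕ → List (Tree d)) k n →
  map (monomial ∘ weightF β) (forests A k n) ≡ ((λ i → map (monomial ∘ weight β) (A i)) ^ˢ k) n
forests-pow β A zero zero = refl
forests-pow β A zero (suc n) = refl
forests-pow β A (suc k) n = trans
  (map-concatMap (monomial ∘ weightF β) _ (upTo (suc n)))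
  (concatMap-cong-∈ _ _ (upTo (suc n)) λ {i} _ → trans (lpMul-weight β (A i) _)
    (cong (lpMul (map (monomial ∘ weight β) (A i))) (forests-pow β A k (n ∸ i))))

series-suc : ∀ d β n → series d β (suc n) ≡ lpShift (sign β) ((series d (not β) ^ˢ d) n)
series-suc d β n = begin
  map (monomial ∘ weight β) (trees d (suc n))                  ≡⟨ cong (map _) (trees-suc d n) ⟩
  map (monomial ∘ weight β) (map node fs)                      ≡⟨ map-∘ fs ⟨
  map (monomial ∘ weight β ∘ node) fs                          ≡⟨ map-∘ fs ⟩
  lpShift (sign β) (map (monomial ∘ weightF (not β)) fs)       ≡⟨ cong (lpShift (sign β)) (forests-pow (not β) (trees d) d n) ⟩
  lpShift (sign β) ((series d (not β) ^ˢ d) n)                 ∎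
  where
  open ≡-Reasoning
  fs = forests (trees d) d n

-- Series operations under permutation of monomials

concatMap-↭ : (f : A → List B) {xs ys : List A} → xs ↭ ys → concatMap f xs ↭ concatMap f ys
concatMap-↭ f _↭_.refl = ↭-refl
concatMap-↭ f (prep x σ) = ++⁺ ↭-refl (concatMap-↭ f σ)
concatMap-↭ f (swap x y σ) = ↭-trans (shifts (f x) (f y)) (++⁺ {x = f y} ↭-refl (++⁺ {x = f x} ↭-refl (concatMap-↭ f σ)))
concatMap-↭ f (_↭_.trans σ τ) = ↭-trans (concatMap-↭ f σ) (concatMap-↭ f τ)

concatMap-cong-↭ : (f g : A → List B) (xs : List A) → (∀ {x} → x ∈ xs → f x ↭ g x) → concatMap f xs ↭ concatMap g xs
concatMap-cong-↭ f g [] eq = ↭-refl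
concatMap-cong-↭ f g (x ∷ xs) eq = ++⁺ (eq (here refl)) (concatMap-cong-↭ f g xs (eq ∘ there))

lpMul-↭ : ∀ {p p′ q q′} → p ↭ p′ → q ↭ q′ → lpMul p q ↭ lpMul p′ q′
lpMul-↭ {p} {p′} {q} {q′} σ τ = ↭-trans (concatMap-↭ _ σ) (concatMap-cong-↭ _ _ p′ λ { {e , c} _ → map-↭ _ τ })

pow-↭ : ∀ {A B : PS} → (∀ i → A i ↭ B i) → ∀ k n → (A ^ˢ k) n ↭ (B ^ˢ k) n
pow-↭ eq zero n = ↭-refl
pow-↭ eq (suc k) n = concatMap-cong-↭ _ _ (upTo (suc n)) λ {i} _ → lpMul-↭ (eq i) (pow-↭ eq k (n ∸ i))

coeff-↭ : ∀ {p q} → p ↭ q → ∀ k → coeff p k ≡ coeff q k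
coeff-↭ _↭_.refl k = refl
coeff-↭ (prep (e , c) σ) k with does (e ℤ.≟ k)
... | true = cong (c ℚ.+_) (coeff-↭ σ k)
... | false = coeff-↭ σ k
coeff-↭ (swap {ys = ys} (e , c) (e′ , c′) σ) k with does (e ℤ.≟ k) | does (e′ ℤ.≟ k)
... | true | false = cong (c ℚ.+_) (coeff-↭ σ k)
... | false | true = cong (c′ ℚ.+_) (coeff-↭ σ k)
... | false | false = coeff-↭ σ k
... | true | true = trans (cong (λ r → c ℚ.+ (c′ ℚ.+ r)) (coeff-↭ σ k))
  (trans (sym (ℚ.+-assoc c c′ _)) (trans (cong (ℚ._+ coeff ys k) (ℚ.+-comm c c′)) (ℚ.+-assoc c′ c _)))
coeff-↭ (_↭_.trans σ τ) k = trans (coeff-↭ σ k) (coeff-↭ τ k)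

-- Eliminating the white series between the two identities gives the equation. For the theorem it
-- then remains to show that `W d` rearranges the black series.
functional-equation : ∀ d (w : PS) → (∀ n → w n ↭ series d true n) →
  w ≈ˢ (psOne ⊕ (t^ (+ 1) x· ((psOne ⊕ (t^ -[1+ 0 ] x· (w ^ˢ d))) ^ˢ d)))
functional-equation d w w↭ n k = coeff-↭ (↭-trans (w↭ n) (rhs n)) k
  where
  white : ∀ n → (psOne ⊕ (t^ -[1+ 0 ] x· (w ^ˢ d))) n ↭ series d false n
  white zero = ↭-refl
  white (suc n) = ↭-trans (map-↭ _ (pow-↭ w↭ d n)) (↭-reflexive (sym (series-suc d false n)))
  rhs : ∀ n → series d true n ↭ (psOne ⊕ (t^ (+ 1) x· ((psOne ⊕ (t^ -[1+ 0 ] x· (w ^ˢ d))) ^ˢ d))) n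
  rhs zero = ↭-refl
  rhs (suc n) = ↭-trans (↭-reflexive (series-suc d true n)) (↭-sym (map-↭ _ (pow-↭ white d n)))

-- Polygons as increasing lists of vertices

Increasing : List ℕ → Set
Increasing = AllPairs _<_

Polygon : List ℕ → Set
Polygon p = Increasing p × 3 ≤ length p

Inside : ℕ → ℕ → List ℕ → Set
Inside x y q = ∀ {v} → v ∈ q → x ≤ v × v ≤ y

InGap : List ℕ → List ℕ → Set
InGap p q = ∃ λ x → ∃ λ y → (x , y) ∈ consec p × Inside x y q

-- This is the boundary arc cut off by the closing edge. It runs from the last vertex of `p` through
-- the marked edge to the first, hence a choice for each vertex of `q`.
Outside : List ℕ → List ℕ → Set
Outside p q = ∀ {v} → v ∈ q → (∀ u → u ∈ p → v ≤ u) ⊎ (∀ u → u ∈ p → u ≤ v)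

NonOverlap : List ℕ → List ℕ → Set
NonOverlap p q = InGap p q ⊎ Outside p q

Adjacent : List ℕ → List ℕ → Set
Adjacent p q = ∃ λ e → e ∈ edges p × e ∈ edges q

consec-ends : ∀ {p x y} → (x , y) ∈ consec p → x ∈ p × y ∈ p
consec-ends {_ ∷ _ ∷ _} (here refl) = here refl , there (here refl)
consec-ends {_ ∷ _ ∷ _} (there i) with consec-ends i
... | x∈ , y∈ = there x∈ , there y∈

consec-< : ∀ {p x y} → Increasing p → (x , y) ∈ consec p → x < y
consec-< {_ ∷ _ ∷ _} ((x<y ∷ _) ∷ _) (here refl) = x<y
consec-< {_ ∷ _ ∷ _} (_ ∷ inc) (there i) = consec-< inc i

consec-separates : ∀ {p x y v} → Increasing p → (x , y) ∈ consec p → v ∈ p → v ≤ x ⊎ y ≤ v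
consec-separates {_ ∷ _ ∷ _} _ (here refl) (here refl) = inj₁ ≤-refl
consec-separates {_ ∷ _ ∷ _} _ (here refl) (there (here refl)) = inj₂ ≤-refl
consec-separates {_ ∷ _ ∷ _} (_ ∷ (y< ∷ _)) (here refl) (there (there v∈)) = inj₂ (<⇒≤ (All.lookup y< v∈))
consec-separates {_ ∷ _ ∷ _} (u< ∷ inc) (there i) (here refl) = inj₁ (<⇒≤ (All.lookup u< (proj₁ (consec-ends i))))
consec-separates {_ ∷ _ ∷ _} (_ ∷ inc) (there i) (there v∈) = consec-separates inc i v∈

first-≤ : ∀ {x r v} → Increasing (x ∷ r) → v ∈ x ∷ r → x ≤ v
first-≤ _ (here refl) = ≤-refl
first-≤ (x< ∷ _) (there v∈) = <⇒≤ (All.lookup x< v∈)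

last-∈ : ∀ x r → lastOr x r ∈ x ∷ r
last-∈ x [] = here refl
last-∈ x (y ∷ r) = there (last-∈ y r)

≤-last : ∀ {x r v} → Increasing (x ∷ r) → v ∈ x ∷ r → v ≤ lastOr x r
≤-last {r = []} _ (here refl) = ≤-refl
≤-last {r = y ∷ r} ((x<y ∷ _) ∷ inc) (here refl) = ≤-trans (<⇒≤ x<y) (≤-last inc (here refl))
≤-last {r = y ∷ r} (_ ∷ inc) (there v∈) = ≤-last inc v∈

edge-ends : ∀ {p x y} → (x , y) ∈ edges p → x ∈ p × y ∈ p
edge-ends {z ∷ r} i with ∈-++⁻ (consec (z ∷ r)) i
... | inj₁ j = consec-ends j
... | inj₂ (here refl) = here refl , last-∈ z r

edge-< : ∀ {p x y} → Polygon p → (x , y) ∈ edges p → x < y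
edge-< {z ∷ r} (inc , long) i with ∈-++⁻ (consec (z ∷ r)) i
edge-< {z ∷ r} (inc , long) i | inj₁ j = consec-< inc j
edge-< {z ∷ y ∷ r} ((z< ∷ inc) , long) i | inj₂ (here refl) = All.lookup z< (last-∈ y r)
edge-< {z ∷ []} (_ , s≤s ()) i | inj₂ (here refl)

consec⊆edges : ∀ {p e} → e ∈ consec p → e ∈ edges p
consec⊆edges {_ ∷ _} i = ∈-++⁺ˡ i

closing-edge : ∀ {p a b} → Increasing p → a ∈ p → b ∈ p → Inside a b p → (a , b) ∈ edges p
closing-edge {z ∷ r} {a} {b} inc a∈ b∈ ins = ∈-++⁺ʳ (consec (z ∷ r)) (here (cong₂ _,_
  (≤-antisym (proj₁ (ins (here refl))) (first-≤ inc a∈))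
  (≤-antisym (≤-last inc b∈) (proj₂ (ins (last-∈ z r))))))

-- The common source of contradictions: an impossible position usually squeezes all vertices of a
-- piece onto the two ends of an interval.
not-two-vertices : ∀ {p x y} → Polygon p → ¬ (∀ {v} → v ∈ p → v ≡ x ⊎ v ≡ y)
not-two-vertices {_ ∷ []} (_ , s≤s ()) _
not-two-vertices {_ ∷ _ ∷ []} (_ , s≤s (s≤s ())) _
not-two-vertices {_ ∷ _ ∷ _ ∷ _} (((u<v ∷ u<w ∷ _) ∷ (v<w ∷ _) ∷ _) , _) h
  with h (here refl) | h (there (here refl)) | h (there (there (here refl)))
... | inj₁ refl | inj₁ refl | _ = <-irrefl refl u<v
... | inj₁ refl | inj₂ refl | inj₁ refl = <-irrefl refl u<w
... | inj₁ refl | inj₂ refl | inj₂ refl = <-irrefl refl v<w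
... | inj₂ refl | inj₂ refl | _ = <-irrefl refl u<v
... | inj₂ refl | inj₁ refl | inj₂ refl = <-irrefl refl u<w
... | inj₂ refl | inj₁ refl | inj₁ refl = <-irrefl refl v<w

not-in-own-gap : ∀ {p x y} → Polygon p → (x , y) ∈ consec p → ¬ Inside x y p
not-in-own-gap poly i ins = not-two-vertices poly λ v∈ →
  [ (λ v≤x → inj₁ (≤-antisym v≤x (proj₁ (ins v∈)))) , (λ y≤v → inj₂ (≤-antisym (proj₂ (ins v∈)) y≤v)) ]′
    (consec-separates (proj₁ poly) i v∈)

not-unit-interval : ∀ {p x} → Polygon p → ¬ Inside x (suc x) p
not-unit-interval {x = x} poly ins = not-two-vertices poly λ v∈ → split (ins v∈)
  where
  split : ∀ {v} → x ≤ v × v ≤ suc x → v ≡ x ⊎ v ≡ suc x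
  split (x≤v , v≤sx) with m≤n⇒m<n∨m≡n v≤sx
  ... | inj₁ v<sx = inj₁ (≤-antisym (m<1+n⇒m≤n v<sx) x≤v)
  ... | inj₂ v≡sx = inj₂ v≡sx

-- Vertices of `p` avoid the interior of the gap and vertices of `q` its exterior, so common
-- vertices are its ends. Hence a piece in a gap can share with `p` only the edge of that gap.
gap-shared : ∀ {p q x y x′ y′} → Increasing p → (x , y) ∈ consec p → Inside x y q → x′ < y′ →
  x′ ∈ p × y′ ∈ p → x′ ∈ q × y′ ∈ q → (x′ ≡ x) × (y′ ≡ y)
gap-shared inc i ins x′<y′ (x′∈p , y′∈p) (x′∈q , y′∈q)
  with consec-separates inc i x′∈p | consec-separates inc i y′∈p
... | inj₂ y≤x′ | _ = ⊥-elim (<-irrefl refl (<-≤-trans x′<y′ (≤-trans (proj₂ (ins y′∈q)) y≤x′)))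
... | inj₁ x′≤x | inj₁ y′≤x = ⊥-elim (<-irrefl refl (<-≤-trans x′<y′ (≤-trans y′≤x (proj₁ (ins x′∈q)))))
... | inj₁ x′≤x | inj₂ y≤y′ = ≤-antisym x′≤x (proj₁ (ins x′∈q)) , ≤-antisym (proj₂ (ins y′∈q)) y≤y′

-- Walks up the vertices of `q` while they stay below `p`. The first one above `p` closes a gap
-- around `p`; if there is none, `q` ends where `p` begins.
gap-or-below : ∀ {p z r} → Increasing (z ∷ r) → (∀ u → u ∈ p → z ≤ u) → Outside p (z ∷ r) →
  InGap (z ∷ r) p ⊎ (∀ w u → w ∈ z ∷ r → u ∈ p → w ≤ u)
gap-or-below {r = []} inc z≤p out = inj₂ λ { _ u (here refl) → z≤p u }
gap-or-below {z = z} {z′ ∷ r} (_ ∷ inc) z≤p out with out (there (here refl))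
... | inj₂ p≤z′ = inj₁ (z , z′ , here refl , λ u∈ → z≤p _ u∈ , p≤z′ _ u∈)
... | inj₁ z′≤p with gap-or-below inc z′≤p (out ∘ there)
... | inj₁ (x , y , i , ins) = inj₁ (x , y , there i , ins)
... | inj₂ q≤p = inj₂ λ { _ u (here refl) → z≤p u ; _ u (there w∈) → q≤p _ u w∈ }

-- The relation locates `q` relative to `p`, and `pairwise` tests each pair in one order only,
-- whereas the tree argument needs both. A piece in a gap sees the other one outside. In the
-- converse direction the first vertex of `q` decides whether `q` lies above `p` or has to be
-- scanned for a gap.
nonOverlap-sym : ∀ {p q} → Increasing p → Increasing q → NonOverlap p q → NonOverlap q p
nonOverlap-sym {p} {q} incp incq (inj₁ (x , y , i , ins)) = inj₂ λ v∈ →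
  [ (λ v≤x → inj₁ (λ _ u∈ → ≤-trans v≤x (proj₁ (ins u∈)))) , (λ y≤v → inj₂ (λ _ u∈ → ≤-trans (proj₂ (ins u∈)) y≤v)) ]′
    (consec-separates incp i v∈)
nonOverlap-sym {p} {[]} incp incq (inj₂ out) = inj₂ λ _ → inj₁ λ _ ()
nonOverlap-sym {p} {z ∷ r} incp incq (inj₂ out) with out (here refl)
... | inj₂ p≤z = inj₂ λ v∈ → inj₁ λ _ u∈ → ≤-trans (p≤z _ v∈) (first-≤ incq u∈)
... | inj₁ z≤p with gap-or-below incq z≤p out
... | inj₁ gap = inj₁ gap
... | inj₂ q≤p = inj₂ λ v∈ → inj₂ λ _ u∈ → q≤p _ _ u∈ v∈

-- Trees as dissections of intervals

-- A tree t placed at a dissects the polygon with vertices a , … , a + leaves t; its leaves are the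
-- boundary edges other than {a , a + leaves t}, and the root is the piece containing that edge.
leaves : ∀ {d} → Tree d → ℕ
leavesF : ∀ {d k} → Forest d k → ℕ
leaves leaf = 1
leaves (node f) = leavesF f
leavesF [] = 0
leavesF (t ∷ f) = leaves t + leavesF f

-- The vertices of the root piece. Each child sits on the gap between two consecutive ones, and the
-- width of the gap is its number of leaves.
base : ∀ {d k} → ℕ → Forest d k → List ℕ
corners : ∀ {d k} → ℕ → Forest d k → List ℕ
base a f = a ∷ corners a f
corners a [] = []
corners a (t ∷ f) = base (a + leaves t) f

pieces : ∀ {d} → ℕ → Bool → Tree d → List (List ℕ × Bool)
piecesF : ∀ {d k} → ℕ → Bool → Forest d k → List (List ℕ × Bool)
pieces a β leaf = []
pieces a β (node f) = (base a f , β) ∷ piecesF a (not β) f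
piecesF a γ [] = []
piecesF a γ (t ∷ f) = pieces a γ t ++ piecesF (a + leaves t) γ f

polys : ∀ {d} → ℕ → Tree d → List (List ℕ)
polysF : ∀ {d k} → ℕ → Forest d k → List (List ℕ)
polys a leaf = []
polys a (node f) = base a f ∷ polysF a f
polysF a [] = []
polysF a (t ∷ f) = polys a t ++ polysF (a + leaves t) f

map-proj₁-pieces : ∀ {d} a β (t : Tree d) → map proj₁ (pieces a β t) ≡ polys a t
map-proj₁-piecesF : ∀ {d k} a γ (f : Forest d k) → map proj₁ (piecesF a γ f) ≡ polysF a f
map-proj₁-pieces a β leaf = refl
map-proj₁-pieces a β (node f) = cong (_ ∷_) (map-proj₁-piecesF a (not β) f)
map-proj₁-piecesF a γ [] = refl
map-proj₁-piecesF a γ (t ∷ f) = trans (map-++ proj₁ (pieces a γ t) _)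
  (cong₂ _++_ (map-proj₁-pieces a γ t) (map-proj₁-piecesF (a + leaves t) γ f))

module _ {d : ℕ} where

  -- Positive arity matters: a node without children would collapse its interval to a point.
  leaves-pos : (t : Tree (suc d)) → 0 < leaves t
  leaves-pos leaf = s≤s z≤n
  leaves-pos (node (t ∷ f)) = ≤-trans (leaves-pos t) (m≤m+n (leaves t) (leavesF f))

  corner-bounds : ∀ {k a v} (f : Forest (suc d) k) → v ∈ corners a f → a < v × v ≤ a + leavesF f
  corner-bounds {a = a} (t ∷ f) (here refl) = m<m+n a (leaves-pos t) , +-monoʳ-≤ a (m≤m+n (leaves t) (leavesF f))
  corner-bounds {a = a} {v} (t ∷ f) (there v∈) with corner-bounds f v∈
  ... | lo , hi = ≤-trans (s≤s (m≤m+n a (leaves t))) lo , subst (v ≤_) (+-assoc a (leaves t) (leavesF f)) hi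

  base-bounds : ∀ {k a v} (f : Forest (suc d) k) → v ∈ base a f → a ≤ v × v ≤ a + leavesF f
  base-bounds f (here refl) = ≤-refl , m≤m+n _ (leavesF f)
  base-bounds f (there v∈) with corner-bounds f v∈
  ... | lo , hi = <⇒≤ lo , hi

  base-increasing : ∀ {k a} (f : Forest (suc d) k) → Increasing (base a f)
  corners-increasing : ∀ {k a} (f : Forest (suc d) k) → Increasing (corners a f)
  base-increasing f = All.tabulate (proj₁ ∘ corner-bounds f) ∷ corners-increasing f
  corners-increasing [] = []
  corners-increasing (t ∷ f) = base-increasing f

  base-end : ∀ {k a} (f : Forest (suc d) k) → a + leavesF f ∈ base a f
  base-end {a = a} [] = here (+-identityʳ a)
  base-end {a = a} (t ∷ f) = there (subst (_∈ base (a + leaves t) f)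
    (+-assoc a (leaves t) (leavesF f)) (base-end f))

  length-corners : ∀ {k a} (f : Forest (suc d) k) → length (corners a f) ≡ k
  length-corners [] = refl
  length-corners (t ∷ f) = cong suc (length-corners f)

  child-at : ∀ {k a x y} (f : Forest (suc d) k) → (x , y) ∈ consec (base a f) →
    Σ (Tree (suc d)) λ t → x + leaves t ≡ y × (∀ {p} → p ∈ polys x t → p ∈ polysF a f)
  child-at (t ∷ f) (here refl) = t , refl , ∈-++⁺ˡ
  child-at {a = a} (t ∷ f) (there i) with child-at f i
  ... | t′ , eq , sub = t′ , eq , ∈-++⁺ʳ (polys a t) ∘ sub

-- Both orders of `NonOverlap` are recorded to make the relation symmetric, so that it survives
-- permuting the pieces.
DistinctOK : List ℕ × Bool → List ℕ × Bool → Set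
DistinctOK (p , b) (q , c) = p ≢ q × NonOverlap p q × NonOverlap q p × (Adjacent p q → b ≢ c)

module _ {e : ℕ} where

  base-polygon : ∀ {a} (f : Forest (2 + e) (2 + e)) → Polygon (base a f)
  base-polygon {a} f = base-increasing f , subst (3 ≤_) (cong suc (sym (length-corners {a = a} f))) (s≤s (s≤s (s≤s z≤n)))

  pieces-polygon : ∀ {a β p b} (t : Tree (2 + e)) → (p , b) ∈ pieces a β t → Polygon p × length p ≡ 3 + e
  piecesF-polygon : ∀ {k a γ p b} (f : Forest (2 + e) k) → (p , b) ∈ piecesF a γ f → Polygon p × length p ≡ 3 + e
  pieces-polygon (node f) (here refl) = base-polygon f , cong suc (length-corners f)
  pieces-polygon (node f) (there i) = piecesF-polygon f i
  piecesF-polygon {a = a} {γ} (t ∷ f) i with ∈-++⁻ (pieces a γ t) i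
  ... | inj₁ j = pieces-polygon t j
  ... | inj₂ j = piecesF-polygon f j

  -- Only the root of the tree joins both ends of the interval; this is recorded through its colour.
  pieces-located : ∀ {a β p b} (t : Tree (2 + e)) → (p , b) ∈ pieces a β t →
    Inside a (a + leaves t) p × (a ∈ p → a + leaves t ∈ p → b ≡ β)
  piecesF-located : ∀ {k a γ p b} (f : Forest (2 + e) k) → (p , b) ∈ piecesF a γ f →
    ∃ λ x → ∃ λ y → (x , y) ∈ consec (base a f) × Inside x y p × (x ∈ p → y ∈ p → b ≡ γ)
  pieces-located (node f) (here refl) = base-bounds f , λ _ _ → refl
  pieces-located (node f) (there i) with piecesF-located f i
  ... | x , y , j , ins , _ with consec-ends j
  ... | x∈ , y∈ =
    (λ v∈ → ≤-trans (proj₁ (base-bounds f x∈)) (proj₁ (ins v∈)) , ≤-trans (proj₂ (ins v∈)) (proj₂ (base-bounds f y∈))) ,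
    λ a∈p end∈p → ⊥-elim (not-in-own-gap (base-polygon f) j λ v∈ →
      ≤-trans (proj₁ (ins a∈p)) (proj₁ (base-bounds f v∈)) , ≤-trans (proj₂ (base-bounds f v∈)) (proj₂ (ins end∈p)))
  piecesF-located {a = a} {γ} (t ∷ f) i with ∈-++⁻ (pieces a γ t) i
  ... | inj₁ j = a , a + leaves t , here refl , pieces-located t j
  ... | inj₂ j with piecesF-located f j
  ... | x , y , i′ , rest = x , y , there i′ , rest

  piecesF-inside : ∀ {k a γ p b} (f : Forest (2 + e) k) → (p , b) ∈ piecesF a γ f → Inside a (a + leavesF f) p
  piecesF-inside f i v∈ with piecesF-located f i
  ... | x , y , j , ins , _ with consec-ends j
  ... | x∈ , y∈ = ≤-trans (proj₁ (base-bounds f x∈)) (proj₁ (ins v∈)) , ≤-trans (proj₂ (ins v∈)) (proj₂ (base-bounds f y∈))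

  -- A descendant lies in a gap of the root. If it shares an edge with the root, that edge joins
  -- both ends of the gap, which forces the colour of the child's root, the opposite one. Pieces
  -- below different children meet in at most one vertex and share no edge.
  pieces-ok : ∀ a β (t : Tree (2 + e)) → AllPairs DistinctOK (pieces a β t)
  piecesF-ok : ∀ {k} a γ (f : Forest (2 + e) k) → AllPairs DistinctOK (piecesF a γ f)
  pieces-ok a β leaf = []
  pieces-ok a β (node f) = All.tabulate base-ok ∷ piecesF-ok a (not β) f
    where
    base-ok : ∀ {qc} → qc ∈ piecesF a (not β) f → DistinctOK (base a f , β) qc
    base-ok {q , c} i with piecesF-located f i | piecesF-polygon f i
    ... | x , y , j , ins , col | (polyq , _) =
      (λ { refl → not-in-own-gap (base-polygon f) j ins }) ,
      inj₁ (x , y , j , ins) ,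
      nonOverlap-sym (base-increasing f) (proj₁ polyq) (inj₁ (x , y , j , ins)) ,
      λ { ((x′ , y′) , e∈p , e∈q) β≡c → differ (edge-ends e∈q)
          (gap-shared (base-increasing f) j ins (edge-< polyq e∈q) (edge-ends e∈p) (edge-ends e∈q)) β≡c }
      where
      differ : ∀ {x′ y′} → x′ ∈ q × y′ ∈ q → (x′ ≡ x) × (y′ ≡ y) → β ≢ c
      differ (x∈ , y∈) (refl , refl) β≡c = not-¬ refl (trans β≡c (col x∈ y∈))
  piecesF-ok a γ [] = []
  piecesF-ok a γ (t ∷ f) = AllPairs.++⁺ (pieces-ok a γ t) (piecesF-ok (a + leaves t) γ f)
    (All.tabulate λ i → All.tabulate λ j → separated i j)
    where
    m = a + leaves t
    separated : ∀ {pb qc} → pb ∈ pieces a γ t → qc ∈ piecesF m γ f → DistinctOK pb qc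
    separated {p , b} {q , c} i j =
      (λ { refl → not-two-vertices {y = m} polyp λ v∈ → inj₁ (≤-antisym (hi v∈) (lo v∈)) }) ,
      inj₂ (λ v∈ → inj₂ λ _ u∈ → ≤-trans (hi u∈) (lo v∈)) ,
      inj₂ (λ v∈ → inj₁ λ _ u∈ → ≤-trans (hi v∈) (lo u∈)) ,
      λ { (_ , e∈p , e∈q) → ⊥-elim (<-irrefl refl (<-≤-trans (edge-< polyp e∈p)
        (≤-trans (hi (proj₂ (edge-ends e∈p))) (lo (proj₁ (edge-ends e∈q)))))) }
      where
      polyp = proj₁ (pieces-polygon t i)
      hi : ∀ {v} → v ∈ p → v ≤ m
      hi v∈ = proj₂ (proj₁ (pieces-located t i) v∈)
      lo : ∀ {v} → v ∈ q → m ≤ v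
      lo v∈ = proj₁ (piecesF-inside f j v∈)

-- Both polygons would have the same longest edge.
same-span-overlap : ∀ {p q a b} → Polygon p → Polygon q → Inside a b p → Inside a b q →
  a ∈ p → b ∈ p → a ∈ q → b ∈ q → ¬ NonOverlap p q
same-span-overlap polyp polyq insp insq a∈p b∈p a∈q b∈q (inj₁ (x , y , i , ins)) = not-in-own-gap polyp i λ v∈ →
  ≤-trans (proj₁ (ins a∈q)) (proj₁ (insp v∈)) , ≤-trans (proj₂ (insp v∈)) (proj₂ (ins b∈q))
same-span-overlap polyp polyq insp insq a∈p b∈p a∈q b∈q (inj₂ out) = not-two-vertices polyq λ v∈ →
  [ (λ v≤p → inj₁ (≤-antisym (v≤p _ a∈p) (proj₁ (insq v∈)))) , (λ p≤v → inj₂ (≤-antisym (proj₂ (insq v∈)) (p≤v _ b∈p))) ]′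
    (out v∈)

-- A tree is determined by its pieces

forest-size : ∀ {d k} (f : Forest (suc d) k) → k ≤ leavesF f
forest-size [] = z≤n
forest-size (t ∷ f) = +-mono-≤ (leaves-pos t) (forest-size f)

module _ {e : ℕ} where

  polys⇒pieces : ∀ {a p} β (t : Tree (2 + e)) → p ∈ polys a t → ∃ λ b → (p , b) ∈ pieces a β t
  polys⇒pieces {a} β t p∈ with ∈-map⁻ proj₁ (subst (_ ∈_) (sym (map-proj₁-pieces a β t)) p∈)
  ... | (p , b) , i , refl = b , i

  polys-inside : ∀ {a p} (t : Tree (2 + e)) → p ∈ polys a t → Inside a (a + leaves t) p
  polys-inside t p∈ = proj₁ (pieces-located t (proj₂ (polys⇒pieces true t p∈)))

  module _ {S : List (List ℕ)} (nonOverlap : ∀ {p q} → p ∈ S → q ∈ S → p ≢ q → NonOverlap p q) where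

    -- Two roots over the same interval both contain its ends, so they would overlap if distinct; as
    -- members of `S` they are equal. Their common vertices then fix the intervals of the children.
    tree-determined : ∀ {a} (t t′ : Tree (2 + e)) → (∀ {p} → p ∈ polys a t → p ∈ S) → (∀ {p} → p ∈ polys a t′ → p ∈ S) →
      leaves t ≡ leaves t′ → t ≡ t′
    forest-determined : ∀ {k a a′} (f f′ : Forest (2 + e) k) → (∀ {p} → p ∈ polysF a f → p ∈ S) →
      (∀ {p} → p ∈ polysF a′ f′ → p ∈ S) → base a f ≡ base a′ f′ → f ≡ f′
    tree-determined leaf leaf _ _ _ = refl
    -- A node has arity at least two and hence at least two leaves, while a leaf counts as one.
    tree-determined leaf (node f) _ _ eq = ⊥-elim (<-irrefl eq (≤-trans (s≤s (s≤s z≤n)) (forest-size f)))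
    tree-determined (node f) leaf _ _ eq = ⊥-elim (<-irrefl (sym eq) (≤-trans (s≤s (s≤s z≤n)) (forest-size f)))
    tree-determined {a} (node f) (node f′) sub sub′ eq with ≡-dec _≟_ (base a f) (base a f′)
    ... | yes same = cong node (forest-determined f f′ (sub ∘ there) (sub′ ∘ there) same)
    ... | no differ = ⊥-elim (same-span-overlap (base-polygon f) (base-polygon f′) (base-bounds f)
      (subst (λ l → Inside a (a + l) _) (sym eq) (base-bounds f′)) (here refl) (base-end f) (here refl)
      (subst (λ l → a + l ∈ base a f′) (sym eq) (base-end f′))
      (nonOverlap (sub (here refl)) (sub′ (here refl)) differ))
    forest-determined [] [] _ _ _ = refl
    forest-determined {a = a} {a′} (t ∷ f) (t′ ∷ f′) sub sub′ eq with refl ← ∷-injectiveˡ {x = a} {y = a′} eq = cong₂ _∷_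
      (tree-determined t t′ (sub ∘ ∈-++⁺ˡ) (sub′ ∘ ∈-++⁺ˡ) (+-cancelˡ-≡ a _ _ (∷-injectiveˡ (∷-injectiveʳ eq))))
      (forest-determined f f′ (sub ∘ ∈-++⁺ʳ (polys a t)) (sub′ ∘ ∈-++⁺ʳ (polys a t′)) (∷-injectiveʳ eq))

-- Edges of the pieces of a tree

Shared : List (List ℕ) → ℕ × ℕ → Set
Shared D e = ∃ λ p → ∃ λ q → p ∈ D × q ∈ D × p ≢ q × e ∈ edges p × e ∈ edges q

shared-mono : ∀ {D D′ e} → (∀ {p} → p ∈ D → p ∈ D′) → Shared D e → Shared D′ e
shared-mono sub (p , q , p∈ , q∈ , rest) = p , q , sub p∈ , sub q∈ , rest

module _ {e : ℕ} where

  base-closing-edge : ∀ {a} (f : Forest (2 + e) (2 + e)) → (a , a + leavesF f) ∈ edges (base a f)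
  base-closing-edge f = closing-edge (base-increasing f) (here refl) (base-end f) (base-bounds f)

  -- A gap of the root carries a leaf, and then has length one, or a child whose root has the same
  -- edge as closing edge. The forest version retains `Inside x y q`, which shows that `q` differs
  -- from the base when the base is named as the second owner.
  polys-edges : ∀ {a q x y} (t : Tree (2 + e)) → q ∈ polys a t → (x , y) ∈ edges q →
    (x ≡ a × y ≡ a + leaves t) ⊎ y ≡ suc x ⊎ Shared (polys a t) (x , y)
  polysF-edges : ∀ {k a q x y} (f : Forest (2 + e) k) → q ∈ polysF a f → (x , y) ∈ edges q →
    ((x , y) ∈ consec (base a f) × Inside x y q) ⊎ y ≡ suc x ⊎ Shared (polysF a f) (x , y)
  polys-edges {a} (node f) (here refl) e∈ with ∈-++⁻ (consec (base a f)) e∈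
  ... | inj₂ (here refl) = inj₁ (refl ,
    ≤-antisym (proj₂ (base-bounds f (last-∈ a (corners a f)))) (≤-last (base-increasing f) (base-end f)))
  ... | inj₁ j with child-at f j
  ... | leaf , refl , _ = inj₂ (inj₁ (+-comm _ 1))
  ... | node g , refl , sub = inj₂ (inj₂ (_ , _ , here refl , there (sub (here refl)) ,
    (λ eq → not-in-own-gap (base-polygon f) j (subst (Inside _ _) (sym eq) (base-bounds g))) ,
    consec⊆edges j , base-closing-edge g))
  polys-edges {a} (node f) (there i) e∈ with polysF-edges f i e∈
  ... | inj₁ (j , ins) = inj₂ (inj₂ (_ , _ , here refl , there i ,
    (λ eq → not-in-own-gap (base-polygon f) j (subst (Inside _ _) (sym eq) ins)) , consec⊆edges j , e∈))
  ... | inj₂ (inj₁ eq) = inj₂ (inj₁ eq)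
  ... | inj₂ (inj₂ sh) = inj₂ (inj₂ (shared-mono there sh))
  polysF-edges {a = a} (t ∷ f) i e∈ with ∈-++⁻ (polys a t) i
  polysF-edges {a = a} (t ∷ f) i e∈ | inj₁ j with polys-edges t j e∈
  ... | inj₁ (refl , refl) = inj₁ (here refl , polys-inside t j)
  ... | inj₂ (inj₁ eq) = inj₂ (inj₁ eq)
  ... | inj₂ (inj₂ sh) = inj₂ (inj₂ (shared-mono ∈-++⁺ˡ sh))
  polysF-edges {a = a} (t ∷ f) i e∈ | inj₂ j with polysF-edges f j e∈
  ... | inj₁ (k , ins) = inj₁ (there k , ins)
  ... | inj₂ (inj₁ eq) = inj₂ (inj₁ eq)
  ... | inj₂ (inj₂ sh) = inj₂ (inj₂ (shared-mono (∈-++⁺ʳ (polys a t)) sh))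

  -- Descending into the child whose interval contains the unit edge ends at a leaf, and the parent
  -- of that leaf owns the edge.
  unit-edge-covered : ∀ {a i} (f : Forest (2 + e) (2 + e)) → a ≤ i → i < a + leavesF f →
    ∃ λ q → q ∈ polys a (node f) × (i , suc i) ∈ edges q
  unit-edge-coveredF : ∀ {k a i} (f : Forest (2 + e) k) → a ≤ i → i < a + leavesF f →
    (i , suc i) ∈ consec (base a f) ⊎ ∃ λ q → q ∈ polysF a f × (i , suc i) ∈ edges q
  unit-edge-covered f a≤i i< with unit-edge-coveredF f a≤i i<
  ... | inj₁ j = _ , here refl , consec⊆edges j
  ... | inj₂ (q , q∈ , e∈) = q , there q∈ , e∈
  unit-edge-coveredF {a = a} [] a≤i i< = ⊥-elim (<-irrefl refl (≤-<-trans a≤i (subst (_ <_) (+-identityʳ a) i<)))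
  unit-edge-coveredF {a = a} {i} (t ∷ f) a≤i i< with i <? a + leaves t
  unit-edge-coveredF {a = a} {i} (leaf ∷ f) a≤i i< | yes i<a+1
    with refl ← ≤-antisym a≤i (m<1+n⇒m≤n (subst (i <_) (+-comm a 1) i<a+1)) = inj₁ (here (cong (i ,_) (+-comm 1 i)))
  unit-edge-coveredF (node g ∷ f) a≤i i< | yes i<m with unit-edge-covered g a≤i i<m
  ... | q , q∈ , e∈ = inj₂ (q , ∈-++⁺ˡ q∈ , e∈)
  unit-edge-coveredF {a = a} {i} (t ∷ f) a≤i i< | no i≮m
    with unit-edge-coveredF f (≮⇒≥ i≮m) (subst (i <_) (sym (+-assoc a (leaves t) (leavesF f))) i<)
  ... | inj₁ j = inj₁ (there j)
  ... | inj₂ (q , q∈ , e∈) = inj₂ (q , ∈-++⁺ʳ (polys a t) q∈ , e∈)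

-- Reconstruction of the tree from a dissection

gap-shorter : ∀ {p a b x y} → Polygon p → Inside a b p → (x , y) ∈ consec p → y ∸ x < b ∸ a
gap-shorter {a = a} {b} {x} {y} poly ins i with consec-ends i
... | x∈ , y∈ with m≤n⇒m<n∨m≡n (proj₁ (ins x∈)) | m≤n⇒m<n∨m≡n (proj₂ (ins y∈))
... | inj₁ a<x | _ = <-≤-trans (∸-monoʳ-< a<x (<⇒≤ (consec-< (proj₁ poly) i))) (∸-monoˡ-≤ a (proj₂ (ins y∈)))
... | inj₂ refl | inj₁ y<b = ∸-monoˡ-< y<b (<⇒≤ (consec-< (proj₁ poly) i))
... | inj₂ refl | inj₂ refl = ⊥-elim (not-in-own-gap poly i ins)

module _ {e M : ℕ} {D : List (List ℕ)}
  (polygon : ∀ {q} → q ∈ D → Polygon q × length q ≡ 3 + e)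
  (inside : ∀ {q} → q ∈ D → Inside 0 M q)
  (nonOverlap : ∀ {p q} → p ∈ D → q ∈ D → p ≢ q → NonOverlap p q)
  (covered : ∀ {p x y} → p ∈ D → (x , y) ∈ edges p →
    (x ≡ 0 × y ≡ M) ⊎ y ≡ suc x ⊎ ∃ λ q → q ∈ D × p ≢ q × (x , y) ∈ edges q)
  where

  -- The last component says that no piece inside the interval is missed; for the whole polygon it
  -- makes the tree exhaust `D`.
  Fits : ℕ → ℕ → Tree (2 + e) → Set
  Fits a b t = a + leaves t ≡ b × (∀ p → p ∈ polys a t → p ∈ D) × (∀ q → q ∈ D → Inside a b q → q ∈ polys a t)

  assemble : ∀ {k} a r → length r ≡ k → (∀ x y → (x , y) ∈ consec (a ∷ r) → ∃ (Fits x y)) →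
    Σ (Forest (2 + e) k) λ f → corners a f ≡ r × (∀ p → p ∈ polysF a f → p ∈ D) ×
      (∀ x y q → (x , y) ∈ consec (a ∷ r) → q ∈ D → Inside x y q → q ∈ polysF a f)
  assemble {zero} a [] refl fit = [] , refl , (λ _ ()) , λ _ _ _ ()
  assemble {suc k} a (b ∷ r) eq fit with fit a b (here refl) | assemble b r (suc-injective eq) (λ x y i → fit x y (there i))
  ... | t , refl , sub , complete | f , refl , subF , completeF = t ∷ f , refl ,
    (λ p p∈ → [ sub p , subF p ]′ (∈-++⁻ (polys a t) p∈)) ,
    λ { _ _ q (here refl) q∈ ins → ∈-++⁺ˡ (complete q q∈ ins)
      ; x y q (there i) q∈ ins → ∈-++⁺ʳ (polys a t) (completeF x y q i q∈ ins) }

  -- If `q` lies in some gap of `p`, `gap-shared` identifies the gap. If `q` were outside, its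
  -- vertices `x` and `y` would have all of `p` between them, putting `p` into its own gap.
  neighbour-inside : ∀ {p q x y} → p ∈ D → q ∈ D → p ≢ q → (x , y) ∈ consec p → (x , y) ∈ edges q → Inside x y q
  neighbour-inside {p} {q} {x} {y} p∈ q∈ p≢q i e∈ with nonOverlap p∈ q∈ p≢q | proj₁ (polygon p∈)
  ... | inj₁ (x′ , y′ , j , ins) | poly
    with gap-shared (proj₁ poly) j ins (consec-< (proj₁ poly) i) (consec-ends i) (edge-ends e∈)
  ... | refl , refl = ins
  neighbour-inside {p} {q} {x} {y} p∈ q∈ p≢q i e∈ | inj₂ out | poly
    with out (proj₁ (edge-ends e∈)) | out (proj₂ (edge-ends e∈))
  ... | inj₂ p≤x | _ = ⊥-elim (<-irrefl refl (<-≤-trans (consec-< (proj₁ poly) i) (p≤x y (proj₂ (consec-ends i)))))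
  ... | _ | inj₁ y≤p = ⊥-elim (<-irrefl refl (<-≤-trans (consec-< (proj₁ poly) i) (y≤p x (proj₁ (consec-ends i)))))
  ... | inj₁ x≤p | inj₂ p≤y = ⊥-elim (not-in-own-gap poly i λ v∈ → x≤p _ v∈ , p≤y _ v∈)

  -- Recursion into the pieces glued to p along its gaps; gas bounds the length of the interval.
  reconstruct : ∀ gas {a b p} → b ∸ a < gas → p ∈ D → a ∈ p → b ∈ p → Inside a b p → ∃ (Fits a b)
  reconstruct (suc gas) {a} {b} {z ∷ r} b∸a< p∈ a∈p b∈p insp
    with polygon p∈
  ... | poly , len with ≤-antisym (proj₁ (insp (here refl))) (first-≤ (proj₁ poly) a∈p)
  ... | refl = node f , end , sub , complete
    where
    child : ∀ x y → (x , y) ∈ consec (a ∷ r) → ∃ (Fits x y)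
    child x y i with covered p∈ (consec⊆edges i)
    -- The marked edge cannot be a gap of `p`, since all of `p` lies between its ends.
    ... | inj₁ (refl , refl) = ⊥-elim (not-in-own-gap poly i (inside p∈))
    ... | inj₂ (inj₁ refl) = leaf , +-comm x 1 , (λ _ ()) ,
      λ q q∈ ins → ⊥-elim (not-unit-interval (proj₁ (polygon q∈)) ins)
    ... | inj₂ (inj₂ (q , q∈ , p≢q , e∈)) =
      -- A gap of `p` is strictly shorter than the interval that `p` spans, so the recursion
      -- terminates.
      reconstruct gas (<-≤-trans (gap-shorter poly insp i) (m<1+n⇒m≤n b∸a<)) q∈
        (proj₁ (edge-ends e∈)) (proj₂ (edge-ends e∈)) (neighbour-inside p∈ q∈ p≢q i e∈)
    assembled = assemble a r (suc-injective len) child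
    f = proj₁ assembled
    base≡ : base a f ≡ a ∷ r
    base≡ = cong (a ∷_) (proj₁ (proj₂ assembled))
    end : a + leavesF f ≡ b
    end = ≤-antisym (proj₂ (insp (subst (a + leavesF f ∈_) base≡ (base-end f))))
      (proj₂ (base-bounds f (subst (b ∈_) (sym base≡) b∈p)))
    sub : ∀ p → p ∈ polys a (node f) → p ∈ D
    sub _ (here refl) = subst (_∈ D) (sym base≡) p∈
    sub p (there i) = proj₁ (proj₂ (proj₂ assembled)) p i
    complete : ∀ q → q ∈ D → Inside a b q → q ∈ polys a (node f)
    complete q q∈ ins with ≡-dec _≟_ (a ∷ r) q
    ... | yes refl = here (sym base≡)
    ... | no p≢q with nonOverlap p∈ q∈ p≢q
    ... | inj₁ (x , y , i , ins′) = there (proj₂ (proj₂ (proj₂ assembled)) x y q i q∈ ins′)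
    -- Both `a` and `b` are vertices of `p`, so a piece outside `p` but within the interval has no
    -- other vertices than these two.
    ... | inj₂ out = ⊥-elim (not-two-vertices (proj₁ (polygon q∈)) λ v∈ →
      [ (λ v≤p → inj₁ (≤-antisym (v≤p a a∈p) (proj₁ (ins v∈)))) ,
        (λ p≤v → inj₂ (≤-antisym (proj₂ (ins v∈)) (p≤v b b∈p))) ]′ (out v∈))

-- Enumerations without repetition

-- In a duplicate-free list each membership has only one proof, so mutual inclusion is already a
-- bijection of memberships, that is, equality of bags.
unique-↭ : {xs ys : List A} → Unique xs → Unique ys → (∀ {x} → x ∈ xs → x ∈ ys) → (∀ {x} → x ∈ ys → x ∈ xs) → xs ↭ ys
unique-↭ {A} {xs} {ys} ux uy to from = ∼bag⇒↭ (mk↔ₛ′ to from (λ i → irrelevant uy (to (from i)) i) (λ i → irrelevant ux (from (to i)) i))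
  where
  irrelevant : ∀ {zs : List A} → Unique zs → ∀ {z} (i j : z ∈ zs) → i ≡ j
  irrelevant = unique⇒irrelevant (setoid A) (λ { refl refl → refl })

allPairs-distinct : {R : A → A → Set} {xs : List A} → AllPairs R xs → ∀ {x y} → x ∈ xs → y ∈ xs → x ≢ y → R x y ⊎ R y x
allPairs-distinct (rx ∷ rxs) (here refl) (here refl) x≢y = ⊥-elim (x≢y refl)
allPairs-distinct (rx ∷ rxs) (here refl) (there y∈) _ = inj₁ (All.lookup rx y∈)
allPairs-distinct (rx ∷ rxs) (there x∈) (here refl) _ = inj₂ (All.lookup rx x∈)
allPairs-distinct (rx ∷ rxs) (there x∈) (there y∈) x≢y = allPairs-distinct rxs x∈ y∈ x≢y

unique⇒allPairs : {R : A → A → Set} {xs : List A} → Unique xs → (∀ {x y} → x ∈ xs → y ∈ xs → x ≢ y → R x y) → AllPairs R xs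
unique⇒allPairs [] r = []
unique⇒allPairs (x∉ ∷ u) r = All.tabulate (λ y∈ → r (here refl) (there y∈) (All.lookup x∉ y∈)) ∷
  unique⇒allPairs u (λ x∈ y∈ → r (there x∈) (there y∈))

allPairs-resp-↭ : {R : A → A → Set} → (∀ {x y} → R x y → R y x) → {xs ys : List A} → xs ↭ ys → AllPairs R xs → AllPairs R ys
allPairs-resp-↭ s _↭_.refl rs = rs
allPairs-resp-↭ s (prep x σ) (r ∷ rs) = All-resp-↭ σ r ∷ allPairs-resp-↭ s σ rs
allPairs-resp-↭ s (swap x y σ) ((r ∷ rx) ∷ ry ∷ rs) = (s r ∷ All-resp-↭ σ ry) ∷ All-resp-↭ σ rx ∷ allPairs-resp-↭ s σ rs
allPairs-resp-↭ s (_↭_.trans σ τ) rs = allPairs-resp-↭ s τ (allPairs-resp-↭ s σ rs)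

unique-map : (f : A → B) {xs : List A} → (∀ {x y} → x ∈ xs → y ∈ xs → f x ≡ f y → x ≡ y) → Unique xs → Unique (map f xs)
unique-map f inj u = AllPairs.map⁺ (unique⇒allPairs u λ x∈ y∈ x≢y eq → x≢y (inj x∈ y∈ eq))

distinct-length : {xs : List A} {x y : A} → x ∈ xs → y ∈ xs → x ≢ y → 2 ≤ length xs
distinct-length (here refl) (here refl) x≢y = ⊥-elim (x≢y refl)
distinct-length {xs = _ ∷ _ ∷ _} _ _ _ = s≤s (s≤s z≤n)
distinct-length {xs = _ ∷ []} (there ()) _ _
distinct-length {xs = _ ∷ []} _ (there ()) _

other-member : ∀ {xs : List (List ℕ)} p → Unique xs → 2 ≤ length xs → ∃ λ q → q ∈ xs × p ≢ q
other-member {[]} p u ()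
other-member {_ ∷ []} p u (s≤s ())
other-member {x ∷ y ∷ _} p ((x≢y ∷ _) ∷ _) _ with ≡-dec _≟_ p x
... | yes refl = y , there (here refl) , x≢y
... | no p≢x = x , here refl , p≢x

choose-⊆ : ∀ k xs {p v} → p ∈ choose k xs → v ∈ p → v ∈ xs
choose-⊆ zero xs (here refl) ()
choose-⊆ (suc k) (x ∷ xs) i v∈ with ∈-++⁻ (map (x ∷_) (choose k xs)) i
... | inj₂ j = there (choose-⊆ (suc k) xs j v∈)
... | inj₁ j with ∈-map⁻ (x ∷_) j
choose-⊆ (suc k) (x ∷ xs) i (here refl) | inj₁ j | _ , _ , refl = here refl
choose-⊆ (suc k) (x ∷ xs) i (there v∈) | inj₁ j | p , p∈ , refl = there (choose-⊆ k xs p∈ v∈)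

∈-choose⁻ : ∀ k {xs p} → Increasing xs → p ∈ choose k xs → Increasing p × length p ≡ k
∈-choose⁻ zero _ (here refl) = [] , refl
∈-choose⁻ (suc k) {x ∷ xs} (x< ∷ inc) i with ∈-++⁻ (map (x ∷_) (choose k xs)) i
... | inj₂ j = ∈-choose⁻ (suc k) inc j
... | inj₁ j with ∈-map⁻ (x ∷_) j
... | p , p∈ , refl with ∈-choose⁻ k inc p∈
... | incp , refl = All.tabulate (λ v∈ → All.lookup x< (choose-⊆ k xs p∈ v∈)) ∷ incp , refl

∈-choose⁺ : ∀ {xs p} → Increasing xs → Increasing p → (∀ {v} → v ∈ p → v ∈ xs) → p ∈ choose (length p) xs
∈-choose⁺ {p = []} _ _ _ = here refl
∈-choose⁺ {[]} {y ∷ p} _ _ sub with () ← sub (here refl)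
∈-choose⁺ {x ∷ xs} {y ∷ p} (x< ∷ inc) (y< ∷ incp) sub with sub (here refl)
... | here refl = ∈-++⁺ˡ (∈-map⁺ (x ∷_) (∈-choose⁺ inc incp λ v∈ → Any.tail (>⇒≢ (All.lookup y< v∈)) (sub (there v∈))))
... | there y∈ = ∈-++⁺ʳ _ (∈-choose⁺ inc (y< ∷ incp) λ v∈ → Any.tail (>⇒≢ (later v∈)) (sub v∈))
  where
  later : ∀ {v} → v ∈ y ∷ p → x < v
  later (here refl) = All.lookup x< y∈
  later (there v∈) = <-trans (All.lookup x< y∈) (All.lookup y< v∈)

∉-head : {x : A} {xs : List A} → Unique (x ∷ xs) → x ∉ xs
∉-head (x∉ ∷ _) x∈ = All.lookup x∉ x∈ refl

choose-unique : ∀ k {xs} → Unique xs → Unique (choose k xs)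
choose-unique zero u = [] ∷ []
choose-unique (suc k) {[]} u = []
choose-unique (suc k) {x ∷ xs} (x∉ ∷ u) = Unique.++⁺ (Unique.map⁺ ∷-injectiveʳ (choose-unique k u)) (choose-unique (suc k) u)
  λ (i , j) → disjoint i j
  where
  disjoint : ∀ {p} → p ∈ map (x ∷_) (choose k xs) → p ∉ choose (suc k) xs
  disjoint i j with ∈-map⁻ (x ∷_) i
  ... | _ , _ , refl = ∉-head (x∉ ∷ u) (choose-⊆ (suc k) xs j (here refl))

sublists-⊆ : (xs : List A) {ys : List A} {v : A} → ys ∈ sublists xs → v ∈ ys → v ∈ xs
sublists-⊆ [] (here refl) ()
sublists-⊆ (x ∷ xs) i v∈ with ∈-++⁻ (map (x ∷_) (sublists xs)) i
... | inj₂ j = there (sublists-⊆ xs j v∈)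
... | inj₁ j with ∈-map⁻ (x ∷_) j
sublists-⊆ (x ∷ xs) i (here refl) | inj₁ j | _ , _ , refl = here refl
sublists-⊆ (x ∷ xs) i (there v∈) | inj₁ j | ys , ys∈ , refl = there (sublists-⊆ xs ys∈ v∈)

∈-sublists-unique : {xs ys : List A} → Unique xs → ys ∈ sublists xs → Unique ys
∈-sublists-unique {xs = []} u (here refl) = []
∈-sublists-unique {xs = x ∷ xs} (x∉ ∷ u) i with ∈-++⁻ (map (x ∷_) (sublists xs)) i
... | inj₂ j = ∈-sublists-unique u j
... | inj₁ j with ∈-map⁻ (x ∷_) j
... | ys , ys∈ , refl = All.tabulate (λ v∈ → All.lookup x∉ (sublists-⊆ xs ys∈ v∈)) ∷ ∈-sublists-unique u ys∈

sublists-unique : {xs : List A} → Unique xs → Unique (sublists xs)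
sublists-unique {xs = []} u = [] ∷ []
sublists-unique {xs = x ∷ xs} (x∉ ∷ u) = Unique.++⁺ (Unique.map⁺ ∷-injectiveʳ (sublists-unique u)) (sublists-unique u)
  λ (i , j) → disjoint i j
  where
  disjoint : ∀ {ys} → ys ∈ map (x ∷_) (sublists xs) → ys ∉ sublists xs
  disjoint i j with ∈-map⁻ (x ∷_) i
  ... | _ , _ , refl = ∉-head (x∉ ∷ u) (sublists-⊆ xs j (here refl))

filter-∈-sublists : {P : A → Set} (P? : ∀ x → Dec (P x)) (xs : List A) → filter P? xs ∈ sublists xs
filter-∈-sublists P? [] = here refl
filter-∈-sublists P? (x ∷ xs) with does (P? x)
... | true = ∈-++⁺ˡ (∈-map⁺ (x ∷_) (filter-∈-sublists P? xs))
... | false = ∈-++⁺ʳ _ (filter-∈-sublists P? xs)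

-- Members of `sublists xs` keep the order of `xs`. This turns a permutation of dissections' pieces
-- into an equality of lists.
sublist-determined : {xs ys zs : List A} → Unique xs → ys ∈ sublists xs → zs ∈ sublists xs →
  (∀ {v} → v ∈ ys → v ∈ zs) → (∀ {v} → v ∈ zs → v ∈ ys) → ys ≡ zs
sublist-determined {xs = []} u (here refl) (here refl) _ _ = refl
sublist-determined {A} {xs = x ∷ xs} (x∉ ∷ u) i j to from
  with ∈-++⁻ (map (x ∷_) (sublists xs)) i | ∈-++⁻ (map (x ∷_) (sublists xs)) j
... | inj₂ i′ | inj₂ j′ = sublist-determined u i′ j′ to from
... | inj₁ i′ | inj₂ j′ with _ , _ , refl ← ∈-map⁻ (x ∷_) i′ = ⊥-elim (∉-head (x∉ ∷ u) (sublists-⊆ xs j′ (to (here refl))))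
... | inj₂ i′ | inj₁ j′ with _ , _ , refl ← ∈-map⁻ (x ∷_) j′ = ⊥-elim (∉-head (x∉ ∷ u) (sublists-⊆ xs i′ (from (here refl))))
... | inj₁ i′ | inj₁ j′ with ∈-map⁻ (x ∷_) i′ | ∈-map⁻ (x ∷_) j′
... | ys′ , ys∈ , refl | zs′ , zs∈ , refl = cong (x ∷_) (sublist-determined u ys∈ zs∈
  (λ v∈ → drop (sublists-⊆ xs ys∈ v∈) (to (there v∈))) (λ v∈ → drop (sublists-⊆ xs zs∈ v∈) (from (there v∈))))
  where
  drop : ∀ {v} {ws : List A} → v ∈ xs → v ∈ x ∷ ws → v ∈ ws
  drop v∈xs = Any.tail λ { refl → ∉-head (x∉ ∷ u) v∈xs }

∈-boolLists : ∀ c → c ∈ boolLists (length c)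
∈-boolLists [] = here refl
∈-boolLists (true ∷ c) = ∈-++⁺ˡ (∈-map⁺ (true ∷_) (∈-boolLists c))
∈-boolLists (false ∷ c) = ∈-++⁺ʳ _ (∈-map⁺ (false ∷_) (∈-boolLists c))

boolLists-unique : ∀ k → Unique (boolLists k)
boolLists-unique zero = [] ∷ []
boolLists-unique (suc k) = Unique.++⁺ (Unique.map⁺ ∷-injectiveʳ (boolLists-unique k)) (Unique.map⁺ ∷-injectiveʳ (boolLists-unique k))
  λ (i , j) → disjoint i j
  where
  disjoint : ∀ {c} → c ∈ map (true ∷_) (boolLists k) → c ∉ map (false ∷_) (boolLists k)
  disjoint i j with ∈-map⁻ (true ∷_) i | ∈-map⁻ (false ∷_) j
  ... | _ , _ , refl | _ , _ , ()

-- The Boolean tests of the definitions as propositions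

∧-elim : ∀ x {y} → T (x ∧ y) → T x × T y
∧-elim x = Equivalence.to (T-∧ {x})

∧-intro : ∀ {x y} → T x → T y → T (x ∧ y)
∧-intro tx ty = Equivalence.from T-∧ (tx , ty)

∨-elim : ∀ x {y} → T (x ∨ y) → T x ⊎ T y
∨-elim x = Equivalence.to (T-∨ {x})

∨-intro : ∀ {x y} → T x ⊎ T y → T (x ∨ y)
∨-intro = Equivalence.from T-∨

implies-elim : ∀ x {y} → T (not x ∨ y) → T x → T y
implies-elim true t _ = t

implies-intro : ∀ x {y} → (T x → T y) → T (not x ∨ y)
implies-intro true f = f tt
implies-intro false f = tt

xor-elim : ∀ x y → T (x xor y) → x ≢ y
xor-elim true true () _
xor-elim false false () _

xor-intro : ∀ x y → x ≢ y → T (x xor y)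
xor-intro true true x≢y = x≢y refl
xor-intro true false _ = tt
xor-intro false true _ = tt
xor-intro false false x≢y = x≢y refl

eqEdge⇒≡ : ∀ e e′ → T (eqEdge e e′) → e ≡ e′
eqEdge⇒≡ (a , b) (c , d) t with ∧-elim (a ≡ᵇ c) t
... | t₁ , t₂ = cong₂ _,_ (≡ᵇ⇒≡ a c t₁) (≡ᵇ⇒≡ b d t₂)

eqEdge-refl : ∀ e → T (eqEdge e e)
eqEdge-refl (a , b) = ∧-intro (≡⇒≡ᵇ a a refl) (≡⇒≡ᵇ b b refl)

any-eqEdge⁻ : ∀ e es → T (any (eqEdge e) es) → e ∈ es
any-eqEdge⁻ e es t = Any.map (eqEdge⇒≡ e _) (Any.any⁻ (eqEdge e) es t)

any-eqEdge⁺ : ∀ {e es} → e ∈ es → T (any (eqEdge e) es)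
any-eqEdge⁺ {e} i = Any.any⁺ (eqEdge e) (Any.map (λ { refl → eqEdge-refl e }) i)

adjacent⁻ : ∀ p q → T (adjacent p q) → Adjacent p q
adjacent⁻ p q t with find (Any.any⁻ (hasEdge q) (edges p) t)
... | e , e∈p , te = e , e∈p , any-eqEdge⁻ e (edges q) te

adjacent⁺ : ∀ p q → Adjacent p q → T (adjacent p q)
adjacent⁺ p q (e , e∈p , e∈q) = Any.any⁺ (hasEdge q) (lose e∈p (any-eqEdge⁺ e∈q))

pairwise⁻ : (R : A → A → Bool) (xs : List A) → T (pairwise R xs) → AllPairs (λ x y → T (R x y)) xs
pairwise⁻ R [] _ = []
pairwise⁻ R (x ∷ xs) t with ∧-elim (all (R x) xs) t
... | t₁ , t₂ = All.all⁺ (R x) xs t₁ ∷ pairwise⁻ R xs t₂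

pairwise⁺ : (R : A → A → Bool) {xs : List A} → AllPairs (λ x y → T (R x y)) xs → T (pairwise R xs)
pairwise⁺ R [] = tt
pairwise⁺ R (r ∷ rs) = ∧-intro (All.all⁻ (R _) r) (pairwise⁺ R rs)

nonOverlapping⁻ : ∀ p q → Increasing p → T (nonOverlapping p q) → NonOverlap p q
nonOverlapping⁻ [] q inc t = inj₂ λ _ → inj₁ λ _ ()
nonOverlapping⁻ (x ∷ r) q inc t with ∨-elim (any _ (consec (x ∷ r))) t
... | inj₁ t₁ with find (Any.any⁻ _ (consec (x ∷ r)) t₁)
... | (a , b) , i , ta = inj₁ (a , b , i , λ {v} v∈ → bounds v (∧-elim (a ≤ᵇ v) (All.lookup (All.all⁺ _ q ta) v∈)))
  where
  bounds : ∀ v → T (a ≤ᵇ v) × T (v ≤ᵇ b) → a ≤ v × v ≤ b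
  bounds v (t₁ , t₂) = ≤ᵇ⇒≤ a v t₁ , ≤ᵇ⇒≤ v b t₂
nonOverlapping⁻ (x ∷ r) q inc t | inj₂ t₂ = inj₂ λ {v} v∈ → sides v (∨-elim (v ≤ᵇ x) (All.lookup (All.all⁺ _ q t₂) v∈))
  where
  sides : ∀ v → T (v ≤ᵇ x) ⊎ T (lastOr x r ≤ᵇ v) → (∀ u → u ∈ x ∷ r → v ≤ u) ⊎ (∀ u → u ∈ x ∷ r → u ≤ v)
  sides v (inj₁ t) = inj₁ λ u u∈ → ≤-trans (≤ᵇ⇒≤ v x t) (first-≤ inc u∈)
  sides v (inj₂ t) = inj₂ λ u u∈ → ≤-trans (≤-last inc u∈) (≤ᵇ⇒≤ (lastOr x r) v t)

nonOverlapping⁺ : ∀ p q → NonOverlap p q → T (nonOverlapping p q)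
nonOverlapping⁺ [] q _ = tt
nonOverlapping⁺ (x ∷ r) q (inj₁ (a , b , i , ins)) = ∨-intro (inj₁ (Any.any⁺ _ (lose i
  (All.all⁻ _ (All.tabulate λ v∈ → ∧-intro (≤⇒≤ᵇ (proj₁ (ins v∈))) (≤⇒≤ᵇ (proj₂ (ins v∈))))))))
nonOverlapping⁺ (x ∷ r) q (inj₂ out) = ∨-intro {any _ (consec (x ∷ r))} (inj₂ (All.all⁻ _ (All.tabulate λ v∈ → ∨-intro
  ([ (λ v≤p → inj₁ (≤⇒≤ᵇ (v≤p x (here refl)))) , (λ p≤v → inj₂ (≤⇒≤ᵇ (p≤v _ (last-∈ x r)))) ]′ (out v∈)))))

-- Dissections correspond to trees

module _ {e : ℕ} where

  polys-pairwise : ∀ {a} (t : Tree (2 + e)) → AllPairs (λ p q → p ≢ q × NonOverlap p q × NonOverlap q p) (polys a t)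
  polys-pairwise {a} t = subst (AllPairs _) (map-proj₁-pieces a true t)
    (AllPairs.map⁺ (AllPairs.map (λ (p≢q , pq , qp , _) → p≢q , pq , qp) (pieces-ok a true t)))

  polys-unique : ∀ {a} (t : Tree (2 + e)) → Unique (polys a t)
  polys-unique t = AllPairs.map proj₁ (polys-pairwise t)

  polys-nonOverlap : ∀ {a p q} (t : Tree (2 + e)) → p ∈ polys a t → q ∈ polys a t → p ≢ q → NonOverlap p q
  polys-nonOverlap t p∈ q∈ p≢q with allPairs-distinct (polys-pairwise t) p∈ q∈ p≢q
  ... | inj₁ (_ , pq , _) = pq
  ... | inj₂ (_ , _ , qp) = qp

  polys-polygon : ∀ {a p} (t : Tree (2 + e)) → p ∈ polys a t → Polygon p × length p ≡ 3 + e
  polys-polygon t p∈ = pieces-polygon t (proj₂ (polys⇒pieces true t p∈))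

  length-polys : ∀ a (t : Tree (2 + e)) → length (polys a t) ≡ nodes t
  length-polysF : ∀ {k} a (f : Forest (2 + e) k) → length (polysF a f) ≡ nodesF f
  length-polys a leaf = refl
  length-polys a (node f) = cong suc (length-polysF a f)
  length-polysF a [] = refl
  length-polysF a (t ∷ f) = trans (length-++ (polys a t)) (cong₂ _+_ (length-polys a t) (length-polysF (a + leaves t) f))

  -- Growing a node in place of a leaf adds `suc e` leaves. The total counts the sides of the
  -- polygon other than the marked edge.
  leaves-nodes : (t : Tree (2 + e)) → leaves t ≡ suc e * nodes t + 1
  leavesF-nodesF : ∀ {k} (f : Forest (2 + e) k) → leavesF f ≡ suc e * nodesF f + k
  leaves-nodes leaf = cong (_+ 1) (sym (*-zeroʳ (suc e)))
  leaves-nodes (node f) = trans (leavesF-nodesF f)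
    (solve 2 (λ e n → (con 1 :+ e) :* n :+ (con 2 :+ e) := (con 1 :+ e) :* (con 1 :+ n) :+ con 1) refl e (nodesF f))
  leavesF-nodesF [] = sym (trans (+-identityʳ _) (*-zeroʳ (suc e)))
  leavesF-nodesF {suc k} (t ∷ f) = trans (cong₂ _+_ (leaves-nodes t) (leavesF-nodesF f))
    (solve 4 (λ e m n k → ((con 1 :+ e) :* m :+ con 1) :+ ((con 1 :+ e) :* n :+ k) := (con 1 :+ e) :* (m :+ n) :+ (con 1 :+ k))
      refl e (nodes t) (nodesF f) k)

upTo-increasing : ∀ m → Increasing (upTo m)
upTo-increasing m = AllPairs.applyUpTo⁺₁ id m λ i<j _ → i<j

module _ {e M : ℕ} where

  ∈-candidates⁻ : ∀ {p} → p ∈ candidates (2 + e) (suc M) → (Polygon p × length p ≡ 3 + e) × Inside 0 M p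
  ∈-candidates⁻ {p} i with ∈-choose⁻ (3 + e) (upTo-increasing (suc M)) i
  ... | inc , len = ((inc , subst (3 ≤_) (sym len) (s≤s (s≤s (s≤s z≤n)))) , len) ,
    λ v∈ → z≤n , m<1+n⇒m≤n (∈-upTo⁻ (choose-⊆ (3 + e) (upTo (suc M)) i v∈))

  ∈-candidates⁺ : ∀ {p} → Polygon p × length p ≡ 3 + e → Inside 0 M p → p ∈ candidates (2 + e) (suc M)
  ∈-candidates⁺ {p} ((inc , _) , len) ins = subst (λ k → p ∈ choose k (upTo (suc M))) len
    (∈-choose⁺ (upTo-increasing (suc M)) inc λ v∈ → ∈-upTo⁺ (s≤s (proj₂ (ins v∈))))

∈-boundaryEdges⁻ : ∀ M {x y} → (x , y) ∈ boundaryEdges (suc M) → (x ≡ 0 × y ≡ M) ⊎ (y ≡ suc x × x < M)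
∈-boundaryEdges⁻ M i with ∈-++⁻ (map (λ i → (i , suc i)) (upTo M)) i
... | inj₂ (here refl) = inj₁ (refl , refl)
... | inj₁ j with ∈-map⁻ (λ i → (i , suc i)) j
... | x , x∈ , refl = inj₂ (refl , ∈-upTo⁻ x∈)

marked∈boundaryEdges : ∀ M → (0 , M) ∈ boundaryEdges (suc M)
marked∈boundaryEdges M = ∈-++⁺ʳ _ (here refl)

unit∈boundaryEdges : ∀ {M x} → x < M → (x , suc x) ∈ boundaryEdges (suc M)
unit∈boundaryEdges x<M = ∈-++⁺ˡ (∈-map⁺ _ (∈-upTo⁺ x<M))

EdgesCovered : ℕ → List (List ℕ) → Set
EdgesCovered m D = (∀ {e} → e ∈ boundaryEdges m → ∃ λ p → p ∈ D × e ∈ edges p) ×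
  (∀ {p e} → p ∈ D → e ∈ edges p → e ∈ boundaryEdges m ⊎ 2 ≤ length (filterᵇ (λ q → hasEdge q e) D))

isDissection⁻ : ∀ m n D → T (isDissection m n D) → AllPairs (λ p q → T (nonOverlapping p q)) D × EdgesCovered m D
isDissection⁻ m n D t with ∧-elim (length D ≡ᵇ n) t
... | _ , t₁ with ∧-elim (pairwise nonOverlapping D) t₁
... | tp , t₂ with ∧-elim (all (λ e → any (λ p → hasEdge p e) D) (boundaryEdges m)) t₂
... | tb , td = pairwise⁻ nonOverlapping D tp , boundary , diagonal
  where
  boundary : ∀ {e} → e ∈ boundaryEdges m → ∃ λ p → p ∈ D × e ∈ edges p
  boundary {e} e∈ with find (Any.any⁻ (λ p → hasEdge p e) D (All.lookup (All.all⁺ _ (boundaryEdges m) tb) e∈))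
  ... | p , p∈ , th = p , p∈ , any-eqEdge⁻ e (edges p) th
  diagonal : ∀ {p e} → p ∈ D → e ∈ edges p → e ∈ boundaryEdges m ⊎ 2 ≤ length (filterᵇ (λ q → hasEdge q e) D)
  diagonal {p} {e} p∈ e∈ with ∨-elim (isBoundary m e) (All.lookup (All.all⁺ _ (edges p) (All.lookup (All.all⁺ _ D td) p∈)) e∈)
  ... | inj₁ te = inj₁ (any-eqEdge⁻ e (boundaryEdges m) te)
  ... | inj₂ t2 = inj₂ (≤ᵇ⇒≤ 2 _ t2)

isDissection⁺ : ∀ {m n D} → length D ≡ n → AllPairs (λ p q → T (nonOverlapping p q)) D → EdgesCovered m D → T (isDissection m n D)
isDissection⁺ {m} {n} {D} len pairs (boundary , diagonal) = ∧-intro (≡⇒≡ᵇ (length D) n len) (∧-intro (pairwise⁺ nonOverlapping pairs) (∧-intro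
  (All.all⁻ _ (All.tabulate λ {e} e∈ → let p , p∈ , e∈p = boundary e∈ in Any.any⁺ (λ p → hasEdge p e) (lose p∈ (any-eqEdge⁺ e∈p))))
  (All.all⁻ _ (All.tabulate λ p∈ → All.all⁻ _ (All.tabulate λ {e} e∈ → ∨-intro {isBoundary m e}
    (Sum.map any-eqEdge⁺ ≤⇒≤ᵇ (diagonal p∈ e∈)))))))

module _ {e n : ℕ} {D : List (List ℕ)} (f : Forest (2 + e) (2 + e)) (D↭ : D ↭ polys 0 (node f)) where

  private
    t = node f
    to : ∀ {p} → p ∈ D → p ∈ polys 0 t
    to = ∈-resp-↭ D↭
    from : ∀ {p} → p ∈ polys 0 t → p ∈ D
    from = ∈-resp-↭ (↭-sym D↭)

  -- Stated up to `↭` because a member of `sublists` follows the order of the candidates and not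
  -- that of the tree.
  tree⇒dissection : nodes t ≡ n → T (isDissection (suc (leaves t)) n D)
  tree⇒dissection eq = isDissection⁺ {m = suc (leaves t)} (trans (↭-length D↭) (trans (length-polys 0 t) eq))
    (unique⇒allPairs (allPairs-resp-↭ (λ p≢q q≡p → p≢q (sym q≡p)) (↭-sym D↭) (polys-unique t))
      λ {p} {q} p∈ q∈ p≢q → nonOverlapping⁺ p q (polys-nonOverlap t (to p∈) (to q∈) p≢q))
    (boundary , diagonal)
    where
    boundary : ∀ {x} → x ∈ boundaryEdges (suc (leaves t)) → ∃ λ p → p ∈ D × x ∈ edges p
    boundary i with ∈-boundaryEdges⁻ (leaves t) i
    ... | inj₁ (refl , refl) = _ , from (here refl) , base-closing-edge f
    ... | inj₂ (refl , x<M) with unit-edge-covered f z≤n x<M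
    ... | q , q∈ , e∈ = q , from q∈ , e∈
    diagonal : ∀ {p x} → p ∈ D → x ∈ edges p →
      x ∈ boundaryEdges (suc (leaves t)) ⊎ 2 ≤ length (filterᵇ (λ q → hasEdge q x) D)
    diagonal {p} {x , y} p∈ e∈ with polys-edges t (to p∈) e∈
    ... | inj₁ (refl , refl) = inj₁ (marked∈boundaryEdges (leaves t))
    ... | inj₂ (inj₁ refl) = inj₁ (unit∈boundaryEdges (proj₂ (polys-inside t (to p∈) (proj₂ (edge-ends e∈)))))
    ... | inj₂ (inj₂ (r , s , r∈ , s∈ , r≢s , e∈r , e∈s)) = inj₂ (distinct-length
      (∈-filter⁺ _ (from r∈) (any-eqEdge⁺ e∈r)) (∈-filter⁺ _ (from s∈) (any-eqEdge⁺ e∈s)) r≢s)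

-- Reconstruction starts at the owner of the marked edge. All pieces lie between `0` and `M`, so
-- completeness places every one of them in the tree.
dissection⇒tree : ∀ {e M n D} → D ∈ sublists (candidates (2 + e) (suc M)) → T (isDissection (suc M) n D) →
  Σ (Tree (2 + e)) λ t → leaves t ≡ M × D ↭ polys 0 t
dissection⇒tree {e} {M} {n} {D} D∈ tD with isDissection⁻ (suc M) n D tD
... | pairs , boundary , diagonal with boundary (marked∈boundaryEdges M)
... | p , p∈ , e∈ = proj₁ fit , proj₁ (proj₂ fit) ,
  unique-↭ unique (polys-unique (proj₁ fit)) (λ {q} q∈ → proj₂ (proj₂ (proj₂ fit)) q q∈ (inside q∈)) (proj₁ (proj₂ (proj₂ fit)) _)
  where
  cands = candidates (2 + e) (suc M)
  unique : Unique D
  unique = ∈-sublists-unique (choose-unique (3 + e) (Unique.upTo⁺ (suc M))) D∈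
  polygon : ∀ {q} → q ∈ D → Polygon q × length q ≡ 3 + e
  polygon q∈ = proj₁ (∈-candidates⁻ {M = M} (sublists-⊆ cands D∈ q∈))
  inside : ∀ {q} → q ∈ D → Inside 0 M q
  inside q∈ = proj₂ (∈-candidates⁻ {e} (sublists-⊆ cands D∈ q∈))
  nonOverlap : ∀ {p q} → p ∈ D → q ∈ D → p ≢ q → NonOverlap p q
  nonOverlap {p} {q} p∈ q∈ p≢q with proj₁ (polygon p∈) | proj₁ (polygon q∈) | allPairs-distinct pairs p∈ q∈ p≢q
  ... | incp , _ | _ | inj₁ tn = nonOverlapping⁻ p q incp tn
  ... | incp , _ | incq , _ | inj₂ tn = nonOverlap-sym incq incp (nonOverlapping⁻ q p incq tn)
  covered : ∀ {p x y} → p ∈ D → (x , y) ∈ edges p →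
    (x ≡ 0 × y ≡ M) ⊎ y ≡ suc x ⊎ ∃ λ q → q ∈ D × p ≢ q × (x , y) ∈ edges q
  covered {p} {x} {y} p∈ e∈ with diagonal p∈ e∈
  ... | inj₁ b∈ = Sum.map₂ (inj₁ ∘ proj₁) (∈-boundaryEdges⁻ M b∈)
  -- As `D` has no repetitions, two owners of the edge include one different from `p`.
  ... | inj₂ two with other-member p (Unique.filter⁺ _ unique) two
  ... | q , q∈ , p≢q with ∈-filter⁻ (λ q → T? (hasEdge q (x , y))) {xs = D} q∈
  ... | q∈D , th = inj₂ (inj₂ (q , q∈D , p≢q , any-eqEdge⁻ (x , y) (edges q) th))
  -- The whole interval has length `M`, so `suc M` is enough gas.
  fit = reconstruct polygon inside nonOverlap covered (suc M) ≤-refl p∈ (proj₁ (edge-ends e∈)) (proj₂ (edge-ends e∈)) (inside p∈)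

-- Checkerboard colourings

adjacent-sym : ∀ {p q} → Adjacent p q → Adjacent q p
adjacent-sym (e , e∈p , e∈q) = e , e∈q , e∈p

distinctOK-sym : ∀ {x y} → DistinctOK x y → DistinctOK y x
distinctOK-sym {p , _} {q , _} (p≢q , pq , qp , col) = (p≢q ∘ sym) , qp , pq , λ adj c≡b → col (adjacent-sym {q} {p} adj) (sym c≡b)

module _ {e : ℕ} {Z : List (List ℕ × Bool)}
  (alternating : ∀ {p b q c} → (p , b) ∈ Z → (q , c) ∈ Z → p ≢ q → Adjacent p q → b ≢ c) where

  -- The root is fixed by hypothesis. The root of a child shares an edge with it and must take the
  -- other colour. The hypothesis speaks of every member of `Z` spanning the interval, which is the
  -- form that passes on to the children.
  colour-forced : ∀ {a β} (t : Tree (2 + e)) → (∀ {p b} → (p , b) ∈ pieces a β t → ∃ λ c → (p , c) ∈ Z) →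
    (∀ {r c} → (r , c) ∈ Z → (a , a + leaves t) ∈ edges r → Inside a (a + leaves t) r → c ≡ β) →
    ∀ {p b c} → (p , b) ∈ pieces a β t → (p , c) ∈ Z → c ≡ b
  colour-forcedF : ∀ {k a γ} (f : Forest (2 + e) k) → (∀ {p b} → (p , b) ∈ piecesF a γ f → ∃ λ c → (p , c) ∈ Z) →
    (∀ {x y r c} → (x , y) ∈ consec (base a f) → (r , c) ∈ Z → (x , y) ∈ edges r → Inside x y r → c ≡ γ) →
    ∀ {p b c} → (p , b) ∈ piecesF a γ f → (p , c) ∈ Z → c ≡ b
  colour-forced (node f) total root (here refl) z = root z (base-closing-edge f) (base-bounds f)
  colour-forced {a} {β} (node f) total root (there i) z = colour-forcedF f (total ∘ there) child i z
    where
    child : ∀ {x y r c} → (x , y) ∈ consec (base a f) → (r , c) ∈ Z → (x , y) ∈ edges r → Inside x y r → c ≡ not β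
    child j zr e∈ ins with total (here refl)
    ... | c₀ , z₀ with root z₀ (base-closing-edge f) (base-bounds f)
    ... | refl = ¬-not λ c≡β → alternating z₀ zr
      (λ { refl → not-in-own-gap (base-polygon f) j ins }) (_ , consec⊆edges j , e∈) (sym c≡β)
  colour-forcedF {a = a} {γ} (t ∷ f) total root i z with ∈-++⁻ (pieces a γ t) i
  ... | inj₁ j = colour-forced t (total ∘ ∈-++⁺ˡ) (root (here refl)) j z
  ... | inj₂ j = colour-forcedF f (total ∘ ∈-++⁺ʳ (pieces a γ t)) (root ∘ there) j z

zip-map-proj : (zs : List (A × B)) → zip (map proj₁ zs) (map proj₂ zs) ≡ zs
zip-map-proj [] = refl
zip-map-proj (z ∷ zs) = cong (z ∷_) (zip-map-proj zs)

zip-total : (xs : List A) (ys : List B) → length ys ≡ length xs → ∀ {x} → x ∈ xs → ∃ λ y → (x , y) ∈ zip xs ys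
zip-total (x ∷ xs) (y ∷ ys) eq (here refl) = y , here refl
zip-total (x ∷ xs) (y ∷ ys) eq (there x∈) with zip-total xs ys (suc-injective eq) x∈
... | y′ , i = y′ , there i

zip-determined : (zs : List (A × B)) (ys : List B) → length ys ≡ length (map proj₁ zs) →
  (∀ {x y y′} → (x , y) ∈ zs → (x , y′) ∈ zip (map proj₁ zs) ys → y′ ≡ y) → ys ≡ map proj₂ zs
zip-determined [] [] _ _ = refl
zip-determined (z ∷ zs) (y ∷ ys) eq h = cong₂ _∷_ (h (here refl) (here refl))
  (zip-determined zs ys (suc-injective eq) λ i j → h (there i) (there j))

isCheckerboard⁻ : ∀ M D c → T (isCheckerboard (suc M) D c) → length c ≡ length D ×
  (∀ {p b} → (p , b) ∈ zip D c → (0 , M) ∈ edges p → b ≡ true) ×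
  (∀ {p b q c′} → (p , b) ∈ zip D c → (q , c′) ∈ zip D c → p ≢ q → Adjacent p q → b ≢ c′)
isCheckerboard⁻ M D c t with ∧-elim (length c ≡ᵇ length D) t
... | tl , t₁ with ∧-elim (all _ (zip D c)) t₁
... | tm , ta = ≡ᵇ⇒≡ (length c) (length D) tl , marked , alternating
  where
  marked : ∀ {p b} → (p , b) ∈ zip D c → (0 , M) ∈ edges p → b ≡ true
  marked {p} {b} i e∈ = Equivalence.to T-≡
    (implies-elim (hasEdge p (0 , M)) (All.lookup (All.all⁺ _ (zip D c) tm) i) (any-eqEdge⁺ e∈))
  alternating : ∀ {p b q c′} → (p , b) ∈ zip D c → (q , c′) ∈ zip D c → p ≢ q → Adjacent p q → b ≢ c′
  alternating {p} {b} {q} {c′} i j p≢q adj with allPairs-distinct (pairwise⁻ _ (zip D c) ta) i j (p≢q ∘ cong proj₁)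
  ... | inj₁ r = xor-elim b c′ (implies-elim (adjacent p q) r (adjacent⁺ p q adj))
  ... | inj₂ r = λ b≡c′ → xor-elim c′ b (implies-elim (adjacent q p) r (adjacent⁺ q p (adjacent-sym {p} {q} adj))) (sym b≡c′)

isCheckerboard⁺ : ∀ M (zs : List (List ℕ × Bool)) → (∀ {p b} → (p , b) ∈ zs → (0 , M) ∈ edges p → b ≡ true) →
  AllPairs DistinctOK zs → T (isCheckerboard (suc M) (map proj₁ zs) (map proj₂ zs))
isCheckerboard⁺ M zs marked ok rewrite zip-map-proj zs = ∧-intro
  (≡⇒≡ᵇ (length (map proj₂ zs)) (length (map proj₁ zs)) (trans (length-map proj₂ zs) (sym (length-map proj₁ zs))))
  (∧-intro
    (All.all⁻ _ {xs = zs} (All.tabulate λ { {p , b} i → implies-intro (hasEdge p (0 , M))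
      λ th → Equivalence.from T-≡ (marked i (any-eqEdge⁻ (0 , M) (edges p) th)) }))
    (pairwise⁺ _ (AllPairs.map (λ { {p , b} {q , c} (_ , _ , _ , col) →
      implies-intro (adjacent p q) λ ta → xor-intro b c (col (adjacent⁻ p q ta)) }) ok)))

-- Additive over concatenation and invariant under permutation, hence easier to match with `weight`
-- than a difference of two counts.
signSum : List Bool → ℤ
signSum = foldr (λ b z → sign b ℤ.+ z) (+ 0)

blackMinusWhite≡signSum : ∀ c → blackMinusWhite c ≡ signSum c
blackMinusWhite≡signSum [] = refl
blackMinusWhite≡signSum (true ∷ c) = trans
  (ℤ.+-assoc (+ 1) (+ count true c) (ℤ.- (+ count false c))) (cong (λ z → + 1 ℤ.+ z) (blackMinusWhite≡signSum c))
blackMinusWhite≡signSum (false ∷ c) = trans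
  (trans (cong (λ z → + count true c ℤ.+ z) (ℤ.neg-distrib-+ (+ 1) (+ count false c)))
    (x∙yz≈y∙xz (+ count true c) -[1+ 0 ] (ℤ.- (+ count false c))))
  (cong (λ z → -[1+ 0 ] ℤ.+ z) (blackMinusWhite≡signSum c))

signSum-++ : ∀ c c′ → signSum (c ++ c′) ≡ signSum c ℤ.+ signSum c′
signSum-++ [] c′ = sym (ℤ.+-identityˡ _)
signSum-++ (b ∷ c) c′ = trans (cong (λ z → sign b ℤ.+ z) (signSum-++ c c′)) (sym (ℤ.+-assoc (sign b) _ _))

signSum-↭ : ∀ {c c′} → c ↭ c′ → signSum c ≡ signSum c′
signSum-↭ _↭_.refl = refl
signSum-↭ (prep b σ) = cong (λ z → sign b ℤ.+ z) (signSum-↭ σ)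
signSum-↭ (swap b b′ σ) = trans (cong (λ z → sign b ℤ.+ (sign b′ ℤ.+ z)) (signSum-↭ σ)) (x∙yz≈y∙xz (sign b) (sign b′) _)
signSum-↭ (_↭_.trans σ τ) = trans (signSum-↭ σ) (signSum-↭ τ)

signSum-pieces : ∀ {d} a β (t : Tree d) → signSum (map proj₂ (pieces a β t)) ≡ weight β t
signSum-piecesF : ∀ {d k} a γ (f : Forest d k) → signSum (map proj₂ (piecesF a γ f)) ≡ weightF γ f
signSum-pieces a β leaf = refl
signSum-pieces a β (node f) = cong (λ z → sign β ℤ.+ z) (signSum-piecesF a (not β) f)
signSum-piecesF a γ [] = refl
signSum-piecesF a γ (t ∷ f) = trans (cong signSum (map-++ proj₂ (pieces a γ t) _))
  (trans (signSum-++ (map proj₂ (pieces a γ t)) _) (cong₂ ℤ._+_ (signSum-pieces a γ t) (signSum-piecesF (a + leaves t) γ f)))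

colourings : ℕ → List (List ℕ) → LPoly
colourings m D = map (λ c → (blackMinusWhite c , 1ℚ)) (filterᵇ (isCheckerboard m D) (boolLists (length D)))

colourings-tree : ∀ {e D} (t : Tree (2 + e)) → D ↭ polys 0 t →
  colourings (suc (leaves t)) D ↭ [ monomial (weight true t) ]
colourings-tree {e} {D} t D↭
  -- The colours of the tree are carried along the permutation, giving a coloured list `zs` whose
  -- polygons are exactly `D`, in its order.
  with ↭-map-inv proj₁ (↭-trans (↭-reflexive (map-proj₁-pieces 0 true t)) (↭-sym D↭))
... | zs , refl , pieces↭ = ↭-trans (map-↭ _ only) (↭-reflexive (cong (λ k → [ monomial k ]) weight≡))
  where
  c₀ = map proj₂ zs
  weight≡ : blackMinusWhite c₀ ≡ weight true t
  weight≡ = trans (blackMinusWhite≡signSum c₀) (trans (signSum-↭ (map-↭ proj₂ (↭-sym pieces↭))) (signSum-pieces 0 true t))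
  good : T (isCheckerboard (suc (leaves t)) D c₀)
  good = isCheckerboard⁺ (leaves t) zs
    (λ i e∈ → proj₂ (pieces-located t (∈-resp-↭ (↭-sym pieces↭) i)) (proj₁ (edge-ends e∈)) (proj₂ (edge-ends e∈)))
    (allPairs-resp-↭ distinctOK-sym pieces↭ (pieces-ok 0 true t))
  determined : ∀ c → T (isCheckerboard (suc (leaves t)) D c) → c ≡ c₀
  determined c tc with isCheckerboard⁻ (leaves t) D c tc
  ... | len , marked , alternating = zip-determined zs c len λ i j →
    colour-forced alternating t (λ k → zip-total D c len (∈-map⁺ proj₁ (∈-resp-↭ pieces↭ k)))
      (λ z e∈ _ → marked z e∈) (∈-resp-↭ (↭-sym pieces↭) i) j
  check? = λ c → T? (isCheckerboard (suc (leaves t)) D c)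
  len₀ : length c₀ ≡ length D
  len₀ = trans (length-map proj₂ zs) (sym (length-map proj₁ zs))
  only : filterᵇ (isCheckerboard (suc (leaves t)) D) (boolLists (length D)) ↭ [ c₀ ]
  only = unique-↭ (Unique.filter⁺ check? (boolLists-unique (length D))) ([] ∷ [])
    (λ {c} i → here (determined c (proj₂ (∈-filter⁻ check? {xs = boolLists (length D)} i))))
    λ { (here refl) → ∈-filter⁺ check? (subst (λ k → c₀ ∈ boolLists k) len₀ (∈-boolLists c₀)) good }

-- The sum over all dissections

module _ {e n M : ℕ} (M≡ : M ≡ suc e * suc n + 1) where

  private
    d = 2 + e
    cands = candidates d (suc M)
    isDiss? = λ D → T? (isDissection (suc M) (suc n) D)
    _∈pieces?_ : ∀ p (t : Tree d) → Dec (p ∈ polys 0 t)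
    p ∈pieces? t = _∈?_ (≡-dec _≟_) p (polys 0 t)

  -- Filtering the candidates puts the pieces in the order in which they occur in sublists.
  dissection : Tree d → List (List ℕ)
  dissection t = filter (_∈pieces? t) cands

  cands-unique : Unique cands
  cands-unique = choose-unique (3 + e) (Unique.upTo⁺ (suc M))

  trees-leaves : ∀ {t} → t ∈ trees d (suc n) → leaves t ≡ M
  trees-leaves {t} t∈ = trans (leaves-nodes t) (trans (cong (λ k → suc e * k + 1) (∈-treesOfHeight≤⁻ d (suc n) (suc n) t∈)) (sym M≡))

  dissection-↭ : ∀ {t} → leaves t ≡ M → dissection t ↭ polys 0 t
  dissection-↭ {t} leaves≡ = unique-↭ (Unique.filter⁺ (_∈pieces? t) cands-unique) (polys-unique t)
    (λ i → proj₂ (∈-filter⁻ (_∈pieces? t) {xs = cands} i))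
    (λ p∈ → ∈-filter⁺ (_∈pieces? t) (∈-candidates⁺ (polys-polygon t p∈)
      (subst (λ k → Inside 0 k _) leaves≡ (polys-inside t p∈))) p∈)

  -- Equal dissections put the pieces of both trees into one family of non-overlapping polygons,
  -- namely the pieces of `t`.
  dissection-injective : ∀ {t t′} → t ∈ trees d (suc n) → t′ ∈ trees d (suc n) → dissection t ≡ dissection t′ → t ≡ t′
  dissection-injective {t} {t′} t∈ t′∈ eq = tree-determined (polys-nonOverlap t) t t′ id
    (λ p∈ → ∈-resp-↭ (dissection-↭ (trees-leaves t∈)) (subst (_ ∈_) (sym eq)
      (∈-resp-↭ (↭-sym (dissection-↭ (trees-leaves t′∈))) p∈)))
    (trans (trees-leaves t∈) (sym (trees-leaves t′∈)))

  tree-of-dissection : ∀ {D} → D ∈ sublists cands → T (isDissection (suc M) (suc n) D) →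
    ∃ λ t → t ∈ trees d (suc n) × D ≡ dissection t
  tree-of-dissection {D} D∈ tD = enumerated (dissection⇒tree {e} {M} {suc n} D∈ tD)
    where
    enumerated : (Σ (Tree d) λ t → leaves t ≡ M × D ↭ polys 0 t) → ∃ λ t → t ∈ trees d (suc n) × D ≡ dissection t
    enumerated (t , leaves≡ , D↭) = t , subst (λ k → t ∈ trees d k) nodes≡ (∈-trees⁺ t) ,
      sublist-determined cands-unique D∈ (filter-∈-sublists (_∈pieces? t) cands) (∈-resp-↭ σ) (∈-resp-↭ (↭-sym σ))
      where
      -- The number of leaves is an injective function of the number of nodes.
      nodes≡ : nodes t ≡ suc n
      nodes≡ = *-cancelˡ-≡ (nodes t) (suc n) (suc e) (+-cancelʳ-≡ 1 _ _ (trans (sym (leaves-nodes t)) (trans leaves≡ M≡)))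
      σ : D ↭ dissection t
      σ = ↭-trans D↭ (↭-sym (dissection-↭ leaves≡))

  isDissection-dissection : ∀ {t} → t ∈ trees d (suc n) → T (isDissection (suc M) (suc n) (dissection t))
  isDissection-dissection {t} t∈ = subst (λ k → T (isDissection (suc k) (suc n) (dissection t))) (trees-leaves t∈)
    (valid t (∈-treesOfHeight≤⁻ d (suc n) (suc n) t∈) (dissection-↭ (trees-leaves t∈)))
    where
    -- Generalised over the tree to allow case analysis: `leaf` is ruled out by its node count.
    valid : ∀ (t : Tree d) {D} → nodes t ≡ suc n → D ↭ polys 0 t → T (isDissection (suc (leaves t)) (suc n) D)
    valid (node f) eq D↭ = tree⇒dissection f D↭ eq

  dissections-↭ : filterᵇ (isDissection (suc M) (suc n)) (sublists cands) ↭ map dissection (trees d (suc n))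
  dissections-↭ = unique-↭ (Unique.filter⁺ isDiss? (sublists-unique cands-unique))
    (unique-map dissection dissection-injective (treesOfHeight≤-unique d (suc n) (suc n))) to from
    where
    to : ∀ {D} → D ∈ filterᵇ (isDissection (suc M) (suc n)) (sublists cands) → D ∈ map dissection (trees d (suc n))
    to i = let D∈ , tD = ∈-filter⁻ isDiss? {xs = sublists cands} i
               t , t∈ , eq = tree-of-dissection D∈ tD
           in subst (_∈ map dissection (trees d (suc n))) (sym eq) (∈-map⁺ dissection t∈)
    from : ∀ {D} → D ∈ map dissection (trees d (suc n)) → D ∈ filterᵇ (isDissection (suc M) (suc n)) (sublists cands)
    from i = let t , t∈ , eq = ∈-map⁻ dissection i in
      subst (_∈ filterᵇ (isDissection (suc M) (suc n)) (sublists cands)) (sym eq)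
        (∈-filter⁺ isDiss? (filter-∈-sublists (_∈pieces? t) cands) (isDissection-dissection t∈))

  -- Each dissection contributes exactly one monomial. The equation for `m` is a hypothesis because
  -- the vertex count in `w` has the form `suc M` only propositionally.
  sum-over-dissections : ∀ {m} → m ≡ suc M →
    concatMap (colourings m) (filterᵇ (isDissection m (suc n)) (sublists (candidates d m))) ↭ series d true (suc n)
  sum-over-dissections refl = begin
    concatMap (colourings (suc M)) (filterᵇ (isDissection (suc M) (suc n)) (sublists cands)) ↭⟨ concatMap-↭ _ dissections-↭ ⟩
    concatMap (colourings (suc M)) (map dissection ts)            ≡⟨ concatMap-map _ dissection ts ⟩
    concatMap (colourings (suc M) ∘ dissection) ts                ↭⟨ concatMap-cong-↭ _ _ ts single ⟩
    concatMap ([_] ∘ monomial ∘ weight true) ts                   ≡⟨ concatMap-map [_] (monomial ∘ weight true) ts ⟨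
    concatMap [_] (map (monomial ∘ weight true) ts)               ≡⟨ concatMap-pure _ ⟩
    map (monomial ∘ weight true) ts                               ∎
    where
    open PermutationReasoning
    ts = trees d (suc n)
    single : ∀ {t} → t ∈ ts → colourings (suc M) (dissection t) ↭ [ monomial (weight true t) ]
    single {t} t∈ = subst (λ k → colourings (suc k) (dissection t) ↭ [ monomial (weight true t) ]) (trees-leaves t∈)
      (colourings-tree t (dissection-↭ (trees-leaves t∈)))

theorem3p2 : (d : ℕ) → 2 ≤ d →
    W d ≈ˢ (psOne ⊕ (t^ (+ 1) x· ((psOne ⊕ (t^ -[1+ 0 ] x· (W d ^ˢ d))) ^ˢ d)))
theorem3p2 (suc (suc e)) (s≤s (s≤s z≤n)) = functional-equation (2 + e) (W (2 + e)) W↭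
  where
  W↭ : ∀ n → W (2 + e) n ↭ series (2 + e) true n
  W↭ zero = ↭-refl
  -- `nVert` adds two, whereas `M` adds one: the labels run from `0` to `M`.
  W↭ (suc n) = sum-over-dissections refl (+-suc (suc e * suc n) 1)
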